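{- Let $k\ge 1$ be an integer. The deterministic node-averaged complexity (in the LOCAL model, on bounded-degree trees) of the hierarchical $2\frac12$-coloring problem with parameter $k$ is $O\bigl(n^{1/(2^k-1)}\bigr)$.
   Context: **LOCAL model.** The input graph $G=(V,E)$ is a communication network on $n$ nodes. Nodes have unique identifiers from $\{1,\dots,n^{c}\}$ for some constant $c$ and know $n$ (and the maximum degree). Computation proceeds in synchronous rounds; in each round every node may exchange messages of arbitrary size with its neighbors and perform arbitrary local computation. Each node at some round outputs its part of the solution and terminates (its output stays available to its neighbors). Bounded-degree trees are trees of maximum degree at most a constant $\Delta$; $k$ is a constant. **Hierarchical $2\frac12$-coloring with parameter $k$.** There are no input labels; the output labels are $\{W,B,E,D\}$ (white, black, exempt, decline), and each node outputs one label. Each node has a level in $\{1,\dots,k+1\}$ defined by: for $i=1,\dots,k$ in order, let $V_i$ be the set of nodes of degree at most $2$ in the remaining tree (forest); nodes of $V_i$ have level $i$ and are removed. Nodes remaining after step $k$ have level $k+1$. The constraints are: - no node of level $1$ is labeled $E$; - all nodes of level $k+1$ are labeled $E$; - a node of level $i$ with $2\le i\le k$ is labeled $E$ if and only if it is adjacent to a node of lower level labeled $W$, $B$ or $E$; - a node of level $i$ with $1\le i\le k$ labeled $W$ (resp. $B$) has no neighbor of level $i$ labeled $W$ (resp. $B$) or $D$; - no node of level $k$ is labeled $D$. **Node-averaged complexity.** For an algorithm $\mathcal A$ run on $G$, let $T_v^G(\mathcal A)$ be the number of rounds after which $v$ terminates. The node-averaged complexity of a deterministic algorithm $\mathcal A$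 on a graph family $\mathcal G$ is $\max_{G\in\mathcal G}\frac1{|V(G)|}\sum_{v\in V(G)}T_v^G(\mathcal A)$, regarded as a function of $n$ by restricting to $n$-node graphs. The node-averaged complexity of a problem is the lowest node-averaged complexity of an algorithm that solves it. -}

module Defs where

open import Data.Bool using (if_then_else_)
open import Data.Fin using (Fin; zero; suc; inject₁; fromℕ)
open import Data.Fin.Subset using (Subset; ⊤; _∩_; _─_; ∣_∣)
open import Data.Fin.Subset.Properties using (_∈?_)
open import Data.Integer using (+_)
open import Data.Maybe using (Maybe; just; nothing)
open import Data.Nat using (ℕ; zero; suc; _+_; _⊔_; _≤_; _<_; _≤?_; NonZero)
import Data.Nat as ℕ
open import Data.Product using (Σ-syntax; ∃-syntax; _×_)
open import Data.Rational using (ℚ)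
import Data.Rational as ℚ
open import Data.Sum using (_⊎_)
open import Data.Vec using (Vec; tabulate; lookup)
open import Data.Vec.Functional using (foldr)
open import Function using (_∘_)
open import Function.Bundles using (_⇔_)
open import Function.Definitions using (Injective)
open import Relation.Binary.Construct.Closure.ReflexiveTransitive using (Star)
open import Relation.Binary.PropositionalEquality using (_≡_; _≢_)
open import Relation.Nullary using (¬_; does)
open import Algebra.Definitions.RawSemiring ℚ.+-*-rawSemiring using () renaming (_^_ to _^ℚ_)

-- A finite simple graph on Fin n, given by port-numbered adjacency lists;
-- port p of v and port rev v p of nbr v p are the two ends of one edge.
-- The numbering of the ports is arbitrary.
record Graph (n : ℕ) : Set where
  field
    deg     : Fin n → ℕ
    nbr     : ∀ v → Fin (deg v) → Fin n
    rev     : ∀ v (p : Fin (deg v)) → Fin (deg (nbr v p))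
    nbr-rev : ∀ v p → nbr (nbr v p) (rev v p) ≡ v
    nbr-inj : ∀ v → Injective _≡_ _≡_ (nbr v)
    no-loop : ∀ v p → nbr v p ≢ v

  Adj : Fin n → Fin n → Set
  Adj u v = ∃[ p ] nbr u p ≡ v

  maxDegree : ℕ
  maxDegree = foldr _⊔_ 0 deg

  Connected : Set
  Connected = ∀ u v → Star Adj u v

  Cycle : Set
  Cycle = Σ[ m ∈ ℕ ] Σ[ c ∈ (Fin (3 + m) → Fin n) ]
    Injective _≡_ _≡_ c
      × (∀ i → Adj (c (inject₁ i)) (c (suc i)))
      × Adj (c (fromℕ (2 + m))) (c zero)

record IsTree {n : ℕ} (G : Graph n) : Set where
  open Graph G
  field
    nonEmpty  : NonZero n
    connected : Connected
    acyclic   : ¬ Cycle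

-- A tree of maximum degree at most Δ with unique identifiers in {1,…,n^c}.
record Instance (Δ c n : ℕ) : Set where
  field
    graph     : Graph n
    isTree    : IsTree graph
  open Graph graph public
  open IsTree isTree public
  field
    bounded   : maxDegree ≤ Δ
    ident     : Fin n → ℕ
    ident-inj : Injective _≡_ _≡_ ident
    ident≥1   : ∀ v → 1 ≤ ident v
    ident≤n^c : ∀ v → ident v ≤ n ℕ.^ c

-- What a node sees of a neighbour: the message sent to it while the neighbour
-- is running, and only the neighbour's output once it has terminated.
data Packet (M O : Set) : Set where
  running    : M → Packet M O
  terminated : O → Packet M O

record Algorithm (O : Set) : Set₁ where
  field
    Message : Set
    -- indexed by the degree of the node
    State   : ℕ → Set
    init    : (n maxDeg ident d : ℕ) → State d
    send    : ∀ {d} → State d → Fin d → Message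
    step    : ∀ {d} → State d → Vec (Packet Message O) d → State d
    output  : ∀ {d} → State d → Maybe O

module _ {O : Set} (A : Algorithm O) {Δ c n : ℕ} (I : Instance Δ c n) where
  open Algorithm A
  open Instance I

  transmit : ∀ {d} → State d → Fin d → Packet Message O
  transmit s p with output s
  ... | just o  = terminated o
  ... | nothing = running (send s p)

  advance : ∀ {d} → State d → Vec (Packet Message O) d → State d
  advance s ms with output s
  ... | just _  = s
  ... | nothing = step s ms

  stateAfter : ℕ → (v : Fin n) → State (deg v)
  stateAfter zero    v = init n maxDegree (ident v) (deg v)
  stateAfter (suc t) v =
    advance (stateAfter t v)
            (tabulate λ p → transmit (stateAfter t (nbr v p)) (rev v p))

  record TerminatesAfter (v : Fin n) (t : ℕ) (o : O) : Set where
    field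
      outputs : output (stateAfter t v) ≡ just o
      first   : ∀ s → s < t → output (stateAfter s v) ≡ nothing

  record Execution : Set where
    field
      rounds     : Fin n → ℕ
      result     : Fin n → O
      terminates : ∀ v → TerminatesAfter v (rounds v) (result v)

Problem : Set → Set₁
Problem O = ∀ {n} → Graph n → (Fin n → O) → Set

Solves : {O : Set} → ℕ → ℕ → Algorithm O → Problem O → Set
Solves Δ c A P = ∀ {n} (I : Instance Δ c n) →
  Σ[ e ∈ Execution A I ] P (Instance.graph I) (Execution.result e)

average : ∀ {n} .{{_ : NonZero n}} → (Fin n → ℕ) → ℚ
average {n} T = + (foldr _+_ 0 T) ℚ./ n

nodeAverage : ∀ {O : Set} {A : Algorithm O} {Δ c n} {I : Instance Δ c n} →
              Execution A I → ℚ
nodeAverage {I = I} e = average {{Instance.nonEmpty I}} (Execution.rounds e)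

-- q ≤ C · x^(1/m), for q ≥ 0 and m ≥ 1, with both sides raised to the power m.
_≤_·_^1/_ : ℚ → ℕ → ℕ → ℕ → Set
q ≤ C · x ^1/ m = (q ^ℚ m) ℚ.≤ (+ (C ℕ.^ m ℕ.* x) ℚ./ 1)

-- The node-averaged complexity of A on n-node instances is a maximum over all
-- of them, so it is bounded iff every instance is.
NodeAveragedO-root : {O : Set} (Δ c : ℕ) → Algorithm O → ℕ → Set
NodeAveragedO-root Δ c A m =
  ∃[ C ] ∃[ n₀ ] ∀ {n} → n₀ ≤ n → (I : Instance Δ c n) (e : Execution A I) →
    nodeAverage e ≤ C · n ^1/ m

-- On trees of maximum degree at most Δ with identifiers in {1,…,n^c}, the
-- deterministic node-averaged complexity of P is O(n^(1/m)), m ≥ 1.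
ProblemNodeAveragedO-root : {O : Set} (Δ c : ℕ) → Problem O → ℕ → Set₁
ProblemNodeAveragedO-root {O} Δ c P m =
  Σ[ A ∈ Algorithm O ] Solves Δ c A P × NodeAveragedO-root Δ c A m

module _ {n : ℕ} (G : Graph n) where
  open Graph G

  degreeIn : Subset n → Fin n → ℕ
  degreeIn S v = ∣ tabulate (lookup S ∘ nbr v) ∣

  lowDegree : Subset n → Subset n
  lowDegree S = S ∩ tabulate λ v → does (degreeIn S v ≤? 2)

  -- the nodes left after i peeling steps; step i+1 removes
  -- V_{i+1} = lowDegree (remaining i)
  remaining : ℕ → Subset n
  remaining zero    = ⊤
  remaining (suc i) = remaining i ─ lowDegree (remaining i)

  -- level k v is the least i ∈ {1,…,k} with v ∉ remaining i, or k + 1 if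
  -- there is none.
  level : ℕ → Fin n → ℕ
  level zero    v = 1
  level (suc k) v = if does (v ∈? remaining (suc k)) then 2 + k else level k v

data Label : Set where
  W B E D : Label

record IsHierarchicalColoring (k : ℕ) {n : ℕ} (G : Graph n)
                              (out : Fin n → Label) : Set where
  open Graph G
  lvl : Fin n → ℕ
  lvl = level G k
  field
    level-1   : ∀ v → lvl v ≡ 1 → out v ≢ E
    level-k+1 : ∀ v → lvl v ≡ suc k → out v ≡ E
    exempt    : ∀ v → 2 ≤ lvl v → lvl v ≤ k →
                out v ≡ E ⇔
                (∃[ u ] Adj v u × lvl u < lvl v ×
                        (out u ≡ W ⊎ out u ≡ B ⊎ out u ≡ E))
    white     : ∀ v → 1 ≤ lvl v → lvl v ≤ k → out v ≡ W →
                ∀ u → Adj v u → lvl u ≡ lvl v → out u ≢ W × out u ≢ D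
    black     : ∀ v → 1 ≤ lvl v → lvl v ≤ k → out v ≡ B →
                ∀ u → Adj v u → lvl u ≡ lvl v → out u ≢ B × out u ≢ D
    level-k   : ∀ v → lvl v ≡ k → out v ≢ D

Hierarchical2½Coloring : ℕ → Problem Label
Hierarchical2½Coloring k = IsHierarchicalColoring k

{-# OPTIONS --safe #-}

-- Nodes of level i decide at a deadline T i = T (i-1) + γ i + 3.  A node
-- becomes exempt as soon as a lower neighbour terminates with W, B or E; the
-- remaining nodes of level i form paths, and each of them learns, if it can
-- within γ i rounds, the distance to and the identifier of both ends.  Paths
-- shorter than γ i are 2-coloured by the parity of the distance to the end
-- with the smaller identifier, the others answer D.  Every non-exempt node of
-- level i+1 is attached to an end of a D-path of level i, so that
-- γ i · #(i+1) ≤ 2 · #i for the numbers #i of non-exempt nodes of level i.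
-- With γ i = M ^ 2^(i-1) this gives #i · M ^ (2^(i-1) - 1) ≤ 2^(i-1) · n:
-- each level costs O(n · M) rounds in total, exempt nodes being charged to
-- the neighbour that exempted them.  M is taken so that M ^ (2^k - 1) is just
-- above 2^k · n, which leaves too few nodes of level k for a path to answer D.

module Submission where

open import Defs
open import Data.Bool using (Bool; true; false)
open import Data.Fin using (Fin; zero; suc; toℕ; inject₁; fromℕ)
open import Data.Fin.Properties using (any?; toℕ-inject₁; toℕ-fromℕ; toℕ<n; toℕ-injective)
import Data.Fin.Properties as Fin
open import Data.Fin.Subset using (Subset; _∈_; _∉_; _⊆_; ∣_∣; _─_)
open import Data.Fin.Subset.Properties using (_∈?_; x∈p∩q⁺; x∈p∩q⁻; p─q⊆p; x∈p∧x∉q⇒x∈p─q; p⊆q⇒∣p∣≤∣q∣; ∈⊤)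
open import Data.Integer using () renaming (+_ to pos)
import Data.Integer as ℤ
import Data.Integer.Properties as ℤ
open import Data.List using (List; []; _∷_; map; length; filter; allFin; concatMap; _++_; upTo; applyUpTo; cartesianProduct)
import Data.List as List
open import Data.List.Membership.Propositional using (lose) renaming (_∈_ to _∈ˡ_)
open import Data.List.Membership.Propositional.Properties using (∈-∃++; ∈-++⁻; ∈-++⁺ˡ; ∈-++⁺ʳ; ∈-allFin; ∈-filter⁺; ∈-filter⁻; ∈-map⁺; ∈-map⁻; ∈-concatMap⁺; ∈-applyUpTo⁻; ∈-cartesianProduct⁻; ∈-upTo⁻)
open import Data.List.Properties using (map-++; map-∘; map-cong; map-tabulate; length-map; length-++; length-filter; length-tabulate; length-applyUpTo)
open import Data.List.Relation.Binary.Disjoint.Propositional using (Disjoint)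
open import Data.List.Relation.Binary.Subset.Propositional using () renaming (_⊆_ to _⊆ˡ_)
open import Data.List.Relation.Unary.All using ([]; _∷_)
import Data.List.Relation.Unary.All as All
import Data.List.Relation.Unary.All.Properties as All
open import Data.List.Relation.Unary.AllPairs using ([]; _∷_)
import Data.List.Relation.Unary.AllPairs as AllPairs
import Data.List.Relation.Unary.AllPairs.Properties as AllPairs
open import Data.List.Relation.Unary.Any using (here; there)
open import Data.List.Relation.Unary.Unique.Propositional using (Unique)
import Data.List.Relation.Unary.Unique.Propositional.Properties as Unique
open import Data.Maybe using (Maybe; just; nothing; fromMaybe)
open import Data.Maybe.Properties using (just-injective)
open import Data.Nat using (ℕ; zero; suc; _+_; _*_; _∸_; _^_; _≤_; _<_; z≤n; s≤s; _≤?_; _<?_; _≟_; pred; NonZero; >-nonZero; >-nonZero⁻¹)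
open import Data.Nat.ListAction using (sum)
open import Data.Nat.ListAction.Properties using (sum-++)
open import Data.Nat.Properties
open import Data.Nat.Tactic.RingSolver using (solve-∀)
open import Data.Product using (Σ; Σ-syntax; ∃; ∃-syntax; _×_; _,_; proj₁; proj₂)
open import Data.Rational using (ℚ; toℚᵘ; NonNegative)
import Data.Rational as ℚ
import Data.Rational.Properties as ℚ
open import Data.Rational.Unnormalised using (mkℚᵘ; *≤*; *≡*)
import Data.Rational.Unnormalised as ℚᵘ
import Data.Rational.Unnormalised.Properties as ℚᵘ
open import Data.Sum using (_⊎_; inj₁; inj₂)
import Data.Sum as Sum
open import Data.Vec using (Vec; _∷_; tabulate; lookup)
import Data.Vec as Vec
open import Data.Vec.Functional using (foldr)
open import Data.Vec.Properties using (lookup∘tabulate; lookup⇒[]=; []=⇒lookup; tabulate-cong)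
open import Function using (_∘_; id; case_of_)
open import Function.Bundles using (mk⇔)
open import Function.Definitions using (Injective)
open import Relation.Binary.Definitions using (tri<; tri≈; tri>)
open import Relation.Binary.PropositionalEquality
open import Relation.Nullary using (¬_; does; Dec; yes; no; contradiction)
open import Relation.Nullary.Decidable using (_×-dec_; ¬?; dec-true; dec-false; map′)
open import Relation.Unary using (Decidable)
open import Algebra.Definitions.RawSemiring ℚ.+-*-rawSemiring using () renaming (_^_ to _^ℚ_)

-- Deadlines grow with the level, and exempt nodes of high level may be numerous, so they must not
-- wait for them. Charging them elsewhere stays cheap because peeling leaves a node at most two
-- neighbours of its own or a higher level: it is charged at most twice. The same degree bound turns
-- the non-exempt nodes of a level into paths, leaves a walk along a path only one way to go on,
-- and, counted in directed edges, gives the factor 2 between consecutive levels. The obstacle is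
-- that membership in the paths of a level settles only when the lower levels have ended, while
-- messages are exchanged from the start. The doubling exponents balance the levels. With #i about n
-- / (γ 1 ⋯ γ (i-1)), a cost γ i · #i of about n · M asks for γ i = M · γ 1 ⋯ γ (i-1), and the
-- product of all k bounds is M to the power 1 + 2 + ⋯ + 2^(k-1) = 2^k - 1.

-- Sums over lists and sizes of subsets

module _ {a} {A : Set a} (w : A → ℕ) where

  sum-⊆ : ∀ {xs ys : List A} → Unique xs → xs ⊆ˡ ys → sum (map w xs) ≤ sum (map w ys)
  sum-⊆ {[]} [] _ = z≤n
  sum-⊆ {x ∷ xs} {ys} (x∉xs ∷ uniq) xs⊆ys with ∈-∃++ (xs⊆ys (here refl))
  ... | as , bs , refl = begin
    w x + sum (map w xs)                          ≤⟨ +-monoʳ-≤ (w x) (sum-⊆ uniq xs⊆) ⟩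
    w x + sum (map w (as ++ bs))                  ≡⟨ cong (λ l → w x + sum l) (map-++ w as bs) ⟩
    w x + sum (map w as ++ map w bs)              ≡⟨ cong (w x +_) (sum-++ (map w as) _) ⟩
    w x + (sum (map w as) + sum (map w bs))       ≡⟨ sym (+-assoc (w x) _ _) ⟩
    w x + sum (map w as) + sum (map w bs)         ≡⟨ cong (_+ sum (map w bs)) (+-comm (w x) _) ⟩
    sum (map w as) + w x + sum (map w bs)         ≡⟨ +-assoc (sum (map w as)) _ _ ⟩
    sum (map w as) + sum (map w (x ∷ bs))         ≡⟨ sum-++ (map w as) _ ⟨
    sum (map w as ++ map w (x ∷ bs))              ≡⟨ cong sum (map-++ w as (x ∷ bs)) ⟨
    sum (map w (as ++ x ∷ bs))                    ∎
    where
    open ≤-Reasoning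
    xs⊆ : xs ⊆ˡ as ++ bs
    xs⊆ y∈xs with ∈-++⁻ as (xs⊆ys (there y∈xs))
    ... | inj₁ y∈as         = ∈-++⁺ˡ y∈as
    ... | inj₂ (here refl)  = contradiction refl (All.lookup x∉xs y∈xs)
    ... | inj₂ (there y∈bs) = ∈-++⁺ʳ as y∈bs

  sum-map-mono : ∀ {w′ : A → ℕ} xs → (∀ {x} → x ∈ˡ xs → w x ≤ w′ x) →
                 sum (map w xs) ≤ sum (map w′ xs)
  sum-map-mono []       _  = z≤n
  sum-map-mono (x ∷ xs) le = +-mono-≤ (le (here refl)) (sum-map-mono xs (le ∘ there))

  sum-map-+ : ∀ (w′ : A → ℕ) xs →
              sum (map (λ x → w x + w′ x) xs) ≡ sum (map w xs) + sum (map w′ xs)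
  sum-map-+ w′ []       = refl
  sum-map-+ w′ (x ∷ xs) = begin
    w x + w′ x + sum (map (λ x → w x + w′ x) xs)          ≡⟨ cong (w x + w′ x +_) (sum-map-+ w′ xs) ⟩
    w x + w′ x + (sum (map w xs) + sum (map w′ xs))        ≡⟨ +-assoc (w x) _ _ ⟩
    w x + (w′ x + (sum (map w xs) + sum (map w′ xs)))      ≡⟨ cong (w x +_) (sym (+-assoc (w′ x) _ _)) ⟩
    w x + ((w′ x + sum (map w xs)) + sum (map w′ xs))      ≡⟨ cong (λ s → w x + (s + sum (map w′ xs))) (+-comm (w′ x) _) ⟩
    w x + ((sum (map w xs) + w′ x) + sum (map w′ xs))      ≡⟨ cong (w x +_) (+-assoc (sum (map w xs)) _ _) ⟩
    w x + (sum (map w xs) + (w′ x + sum (map w′ xs)))      ≡⟨ sym (+-assoc (w x) _ _) ⟩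
    w x + sum (map w xs) + (w′ x + sum (map w′ xs))        ∎
    where open ≡-Reasoning

  ∈⇒≤sum : ∀ {x xs} → x ∈ˡ xs → w x ≤ sum (map w xs)
  ∈⇒≤sum {xs = _ ∷ xs} (here refl) = m≤m+n _ _
  ∈⇒≤sum {xs = y ∷ xs} (there x∈)  = ≤-trans (∈⇒≤sum x∈) (m≤n+m _ (w y))

sum-map-const : ∀ {a} {A : Set a} (c : ℕ) (xs : List A) →
                sum (map (λ _ → c) xs) ≡ length xs * c
sum-map-const c []       = refl
sum-map-const c (_ ∷ xs) = cong (c +_) (sum-map-const c xs)

sum-map-*ˡ : ∀ {a} {A : Set a} (c : ℕ) (w : A → ℕ) xs →
             sum (map (λ x → c * w x) xs) ≡ c * sum (map w xs)
sum-map-*ˡ c w []       = sym (*-zeroʳ c)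
sum-map-*ˡ c w (x ∷ xs) = trans (cong (c * w x +_) (sum-map-*ˡ c w xs))
                                (sym (*-distribˡ-+ c (w x) _))

length-⊆ : ∀ {a} {A : Set a} {xs ys : List A} → Unique xs → xs ⊆ˡ ys → length xs ≤ length ys
length-⊆ {xs = xs} {ys} uniq xs⊆ys =
  subst₂ _≤_ (trans (sum-map-const 1 xs) (*-identityʳ _)) (trans (sum-map-const 1 ys) (*-identityʳ _))
    (sum-⊆ (λ _ → 1) uniq xs⊆ys)

sum-concatMap : ∀ {a b} {A : Set a} {B : Set b} (w : B → ℕ) (f : A → List B) xs →
                sum (map w (concatMap f xs)) ≡ sum (map (λ x → sum (map w (f x))) xs)
sum-concatMap w f []       = refl
sum-concatMap w f (x ∷ xs) = begin
  sum (map w (f x ++ concatMap f xs))                ≡⟨ cong sum (map-++ w (f x) _) ⟩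
  sum (map w (f x) ++ map w (concatMap f xs))        ≡⟨ sum-++ (map w (f x)) _ ⟩
  sum (map w (f x)) + sum (map w (concatMap f xs))   ≡⟨ cong (sum (map w (f x)) +_) (sum-concatMap w f xs) ⟩
  sum (map w (f x)) + _                              ∎
  where open ≡-Reasoning

length-filter-tabulate : ∀ {a p} {A : Set a} {P : A → Set p} (P? : ∀ x → Dec (P x)) {n} (f : Fin n → A) →
                         length (filter P? (List.tabulate f)) ≡ ∣ tabulate (does ∘ P? ∘ f) ∣
length-filter-tabulate P? {zero}  f = refl
length-filter-tabulate P? {suc n} f with does (P? (f zero))
... | true  = cong suc (length-filter-tabulate P? (f ∘ suc))
... | false = length-filter-tabulate P? (f ∘ suc)

∈-tabulate⁻ : ∀ {n} {f : Fin n → Bool} {i} → i ∈ tabulate f → f i ≡ true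
∈-tabulate⁻ {f = f} {i} i∈ = trans (sym (lookup∘tabulate f i)) ([]=⇒lookup i∈)

∈-tabulate⁺ : ∀ {n} {f : Fin n → Bool} {i} → f i ≡ true → i ∈ tabulate f
∈-tabulate⁺ {f = f} {i} eq = lookup⇒[]= i _ (trans (lookup∘tabulate f i) eq)

x∈p─q⇒x∉q : ∀ {n} {x : Fin n} (p q : Subset n) → x ∈ p ─ q → x ∉ q
x∈p─q⇒x∉q (_ ∷ p) (true ∷ q) (Vec.there x∈) (Vec.there x∈q) = x∈p─q⇒x∉q p q x∈ x∈q
x∈p─q⇒x∉q (_ ∷ p) (false ∷ q) (Vec.there x∈) (Vec.there x∈q) = x∈p─q⇒x∉q p q x∈ x∈q

-- Levels of the peeling process

module Levels {n : ℕ} (G : Graph n) where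
  open Graph G

  remaining-suc⁻ : ∀ {i v} → v ∈ remaining G (suc i) →
                   v ∈ remaining G i × ¬ degreeIn G (remaining G i) v ≤ 2
  remaining-suc⁻ {i} {v} v∈ = v∈R , λ low →
      x∈p─q⇒x∉q R (lowDegree G R) v∈
        (x∈p∩q⁺ (v∈R , ∈-tabulate⁺ (dec-true (degreeIn G R v ≤? 2) low)))
    where
    R   = remaining G i
    v∈R = p─q⊆p R (lowDegree G R) v∈

  remaining-suc⁺ : ∀ {i v} → v ∈ remaining G i → ¬ degreeIn G (remaining G i) v ≤ 2 →
                   v ∈ remaining G (suc i)
  remaining-suc⁺ {i} {v} v∈ high = x∈p∧x∉q⇒x∈p─q v∈ λ v∈low →
    case-true (degreeIn G (remaining G i) v ≤? 2)
      (∈-tabulate⁻ (proj₂ (x∈p∩q⁻ (remaining G i) _ v∈low)))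
    where
    case-true : (d : Dec (degreeIn G (remaining G i) v ≤ 2)) → does d ≢ true
    case-true (yes low) _ = high low

  remaining-anti : ∀ {i j v} → i ≤ j → v ∈ remaining G j → v ∈ remaining G i
  remaining-anti {zero}  _ _ = ∈⊤
  remaining-anti {suc i} {suc j} {v} i≤j v∈ with m≤n⇒m<n∨m≡n i≤j
  ... | inj₁ (s≤s i<j) = remaining-anti i<j (proj₁ (remaining-suc⁻ {j} v∈))
  ... | inj₂ refl      = v∈

  level-suc-∈ : ∀ {k v} → v ∈ remaining G (suc k) → level G (suc k) v ≡ 2 + k
  level-suc-∈ {k} {v} v∈ rewrite dec-true (v ∈? remaining G (suc k)) v∈ = refl

  level-suc-∉ : ∀ {k v} → v ∉ remaining G (suc k) → level G (suc k) v ≡ level G k v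
  level-suc-∉ {k} {v} v∉ rewrite dec-false (v ∈? remaining G (suc k)) v∉ = refl

  level≥1 : ∀ k v → 1 ≤ level G k v
  level≥1 zero    v = s≤s z≤n
  level≥1 (suc k) v with does (v ∈? remaining G (suc k))
  ... | true  = s≤s z≤n
  ... | false = level≥1 k v

  level≤ : ∀ k v → level G k v ≤ suc k
  level≤ zero    v = ≤-refl
  level≤ (suc k) v with does (v ∈? remaining G (suc k))
  ... | true  = ≤-refl
  ... | false = m≤n⇒m≤1+n (level≤ k v)

  remaining⇒level> : ∀ {k i v} → i ≤ k → v ∈ remaining G i → i < level G k v
  remaining⇒level> {zero}  {v = v} z≤n _ = s≤s z≤n
  remaining⇒level> {suc k} {i} {v} i≤ v∈ with v ∈? remaining G (suc k)
  ... | yes v∈′ = s≤s i≤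
  ... | no  v∉ with m≤n⇒m<n∨m≡n i≤
  ...   | inj₁ (s≤s i≤k) = remaining⇒level> i≤k v∈
  ...   | inj₂ refl      = contradiction v∈ v∉

  level>⇒remaining : ∀ {k i v} → i ≤ k → i < level G k v → v ∈ remaining G i
  level>⇒remaining {zero}  z≤n _ = ∈⊤
  level>⇒remaining {suc k} {i} {v} i≤ i< with v ∈? remaining G (suc k)
  ... | yes v∈ = remaining-anti i≤ v∈
  ... | no  _ with m≤n⇒m<n∨m≡n i≤
  ...   | inj₁ (s≤s i≤k) = level>⇒remaining i≤k i<
  ...   | inj₂ refl      = contradiction i< (≤⇒≯ (level≤ k v))

  module _ (k : ℕ) where

    L : Fin n → ℕ
    L = level G k

    ups : ∀ v → List (Fin (deg v))
    ups v = filter (λ p → L v ≤? L (nbr v p)) (allFin (deg v))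

    -- When v is peeled off, its neighbours of at least its own level are all still present, so they
    -- are counted by the degree that was found to be at most 2.
    length-ups : ∀ v → L v ≤ k → length (ups v) ≤ 2
    length-ups v Lv≤k = ≤-trans (≤-reflexive (length-filter-tabulate (λ p → L v ≤? L (nbr v p)) id))
      (≤-trans (p⊆q⇒∣p∣≤∣q∣ sub) low)
      where
      i = pred (L v)
      suc-i : suc i ≡ L v
      suc-i = suc-pred (L v) {{>-nonZero (level≥1 k v)}}
      R = remaining G i
      i≤k : i ≤ k
      i≤k = ≤-trans (n≤1+n i) (≤-trans (≤-reflexive suc-i) Lv≤k)
      low : degreeIn G R v ≤ 2
      low with degreeIn G R v ≤? 2
      ... | yes le = le
      ... | no  ¬le = contradiction
        (remaining⇒level> (≤-trans (≤-reflexive suc-i) Lv≤k)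
          (remaining-suc⁺ {i} (level>⇒remaining i≤k (≤-reflexive suc-i)) ¬le))
        (≤⇒≯ (≤-reflexive (sym suc-i)))
      sub : tabulate (λ p → does (L v ≤? L (nbr v p))) ⊆ tabulate (lookup R ∘ nbr v)
      sub {p} p∈ with L v ≤? L (nbr v p) | ∈-tabulate⁻ p∈
      ... | yes le | _ = ∈-tabulate⁺ ([]=⇒lookup (level>⇒remaining i≤k (≤-trans (≤-reflexive suc-i) le)))
      ... | no ¬le | eq = contradiction (trans (sym (dec-false (L v ≤? L (nbr v p)) ¬le)) eq) λ ()

    -- The degree of v exceeds 2 before peeling step j + 1 and is at most 2 after it, so that step
    -- must have removed a neighbour.
    lower-neighbour : ∀ {j v} → L v ≡ suc (suc j) → L v ≤ k → ∃[ p ] L (nbr v p) ≡ suc j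
    lower-neighbour {j} {v} Lv≡ Lv≤k with any? (λ p → L (nbr v p) ≟ suc j)
    ... | yes found = found
    ... | no  none  = contradiction (≤-trans (p⊆q⇒∣p∣≤∣q∣ sub) low) high
      where
      ssj≤k : suc (suc j) ≤ k
      ssj≤k = subst (_≤ k) Lv≡ Lv≤k
      sj≤k = ≤-trans (n≤1+n _) ssj≤k
      j≤k = ≤-trans (n≤1+n _) sj≤k
      v∈sj : v ∈ remaining G (suc j)
      v∈sj = level>⇒remaining sj≤k (≤-reflexive (sym Lv≡))
      high : ¬ degreeIn G (remaining G j) v ≤ 2
      high = proj₂ (remaining-suc⁻ {j} v∈sj)
      low : degreeIn G (remaining G (suc j)) v ≤ 2
      low with degreeIn G (remaining G (suc j)) v ≤? 2
      ... | yes le = le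
      ... | no ¬le = contradiction (remaining⇒level> ssj≤k (remaining-suc⁺ {suc j} v∈sj ¬le))
                                   (≤⇒≯ (≤-reflexive Lv≡))
      sub : tabulate (lookup (remaining G j) ∘ nbr v) ⊆ tabulate (lookup (remaining G (suc j)) ∘ nbr v)
      sub {p} p∈ = ∈-tabulate⁺ ([]=⇒lookup (level>⇒remaining sj≤k
        (≤∧≢⇒< (remaining⇒level> j≤k (lookup⇒[]= _ _ (∈-tabulate⁻ p∈))) (λ eq → none (p , sym eq)))))

-- Non-backtracking walks in an acyclic graph

module Acyclic {n : ℕ} (G : Graph n) (acyclic : ¬ Graph.Cycle G) where
  open Graph G

  -- A shortest closed stretch of a non-backtracking walk is a cycle.
  nonbacktracking-≢ : (z : ℕ → Fin n) (N : ℕ) →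
    (∀ i → i < N → Adj (z i) (z (suc i))) →
    (∀ i → 2 + i ≤ N → z i ≢ z (2 + i)) →
    ∀ g i → i + suc g ≤ N → z i ≢ z (i + suc g)
  nonbacktracking-≢ z N adj nb g = go g g ≤-refl
    where
    go : ∀ b g → g ≤ b → ∀ i → i + suc g ≤ N → z i ≢ z (i + suc g)
    go b zero _ i le eq with adj i (subst (_≤ N) (+-comm i 1) le)
    ... | p , eq′ = no-loop (z i) p (trans eq′ (trans (cong z (+-comm 1 i)) (sym eq)))
    go b (suc zero) _ i le eq = nb i (subst (_≤ N) (+-comm i 2) le) (trans eq (cong z (+-comm i 2)))
    -- This closed stretch has m + 3 steps. A repetition inside it would be a shorter closed stretch
    -- with another start, so the induction bounds the length by `b` and keeps the start `i` free.
    go (suc b) (suc (suc m)) (s≤s g≤) i le eq = acyclic (m , c , c-inj , c-adj , c-close)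
      where
      c : Fin (3 + m) → Fin n
      c f = z (i + toℕ f)
      c-< : ∀ {f f′ : Fin (3 + m)} → toℕ f < toℕ f′ → c f ≢ c f′
      c-< {f} {f′} lt eq′ with m≤n⇒∃[o]m+o≡n lt
      ... | o , eq″ = go b o (≤-trans (m≤n+m o (toℕ f)) (≤-pred (≤-trans (≤-reflexive eq″) (≤-trans (≤-pred (toℕ<n f′)) (s≤s g≤)))))
                        (i + toℕ f)
                        (≤-trans (≤-reflexive idx) (≤-trans (+-monoʳ-≤ i (<⇒≤ (toℕ<n f′))) le))
                        (trans eq′ (cong z (sym idx)))
        where
        idx : i + toℕ f + suc o ≡ i + toℕ f′
        idx = trans (+-assoc i _ _) (cong (i +_) (trans (+-suc (toℕ f) o) eq″))
      c-inj : Injective _≡_ _≡_ c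
      c-inj {f} {f′} eq′ with <-cmp (toℕ f) (toℕ f′)
      ... | tri< lt _ _ = contradiction eq′ (c-< lt)
      ... | tri≈ _ e _  = toℕ-injective e
      ... | tri> _ _ gt = contradiction (sym eq′) (c-< gt)
      c-adj : ∀ f → Adj (c (inject₁ f)) (c (suc f))
      c-adj f rewrite toℕ-inject₁ f | +-suc i (toℕ f) =
        adj (i + toℕ f) (≤-trans (≤-reflexive (sym (+-suc i (toℕ f))))
                          (≤-trans (+-monoʳ-≤ i (<⇒≤ (s≤s (toℕ<n f)))) le))
      c-close : Adj (c (fromℕ (2 + m))) (c zero)
      c-close rewrite toℕ-fromℕ m | +-identityʳ i =
        subst (Adj (z (i + (2 + m)))) (trans (cong z (sym (+-suc i (2 + m)))) (sym eq))
          (adj (i + (2 + m)) (≤-trans (≤-reflexive (sym (+-suc i (2 + m)))) le))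

-- Darts and walks along the paths of one level

module Walks {n : ℕ} (G : Graph n) (k : ℕ) {On : Fin n → Set} (On? : Decidable On) where
  open Graph G
  open Levels G using (length-ups)

  L : Fin n → ℕ
  L = level G k

  -- A dart (v , p) points at v and comes from nbr v p.
  Dart : Set
  Dart = Σ (Fin n) (Fin ∘ deg)

  head tail : Dart → Fin n
  head = proj₁
  tail (v , p) = nbr v p

  flip : Dart → Dart
  flip (v , p) = nbr v p , rev v p

  dart-≡ : ∀ {d e} → head d ≡ head e → tail d ≡ tail e → d ≡ e
  dart-≡ {v , _} refl eq = cong (v ,_) (nbr-inj v eq)

  tail-flip : ∀ d → tail (flip d) ≡ head d
  tail-flip (v , p) = nbr-rev v p

  flip-flip : ∀ d → flip (flip d) ≡ d
  flip-flip d = dart-≡ (tail-flip d) (tail-flip (flip d))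

  Open : ∀ v → Fin (deg v) → Set
  Open v p = L (nbr v p) ≡ L v × On (nbr v p)

  open? : ∀ v → Decidable (Open v)
  open? v p = (L (nbr v p) ≟ L v) ×-dec On? (nbr v p)

  Continues : (d : Dart) → Fin (deg (head d)) → Set
  Continues (v , p) q = Open v q × q ≢ p

  continues? : ∀ d → Dec (∃ (Continues d))
  continues? (v , p) = any? λ q → open? v q ×-dec ¬? (q Fin.≟ p)

  -- The dart arrives through one of the at most two upward ports of its head, which leaves at most
  -- one way on. The tail may be of higher level, so that a walk can also enter a path from outside
  -- at one of its ends.
  Good : Dart → Set
  Good d = L (head d) ≤ k × L (head d) ≤ L (tail d)

  ups-≤2 : ∀ {v p q r} → L v ≤ k → L v ≤ L (nbr v p) → L v ≤ L (nbr v q) → L v ≤ L (nbr v r) →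
           p ≢ q → p ≢ r → q ≡ r
  ups-≤2 {v} {p} {q} {r} Lv≤k up uq ur p≢q p≢r with q Fin.≟ r
  ... | yes q≡r = q≡r
  ... | no  q≢r = contradiction (≤-trans (length-⊆ uniq sub) (length-ups k v Lv≤k)) λ { (s≤s (s≤s ())) }
    where
    uniq : _
    uniq = (p≢q ∷ p≢r ∷ []) ∷ (q≢r ∷ []) ∷ [] ∷ []
    sub : ∀ {x} → x ∈ˡ p ∷ q ∷ r ∷ [] → x ∈ˡ Levels.ups G k v
    sub (here refl)                 = ∈-filter⁺ _ (∈-allFin _) up
    sub (there (here refl))         = ∈-filter⁺ _ (∈-allFin _) uq
    sub (there (there (here refl))) = ∈-filter⁺ _ (∈-allFin _) ur

  continues-unique : ∀ {d q r} → Good d → Continues d q → Continues d r → q ≡ r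
  continues-unique (≤k , up) ((eq , _) , q≢) ((eq′ , _) , r≢) =
    ups-≤2 ≤k up (≤-reflexive (sym eq)) (≤-reflexive (sym eq′)) (q≢ ∘ sym) (r≢ ∘ sym)

  good-flip : ∀ {v q} → L v ≤ k → Open v q → Good (flip (v , q))
  good-flip {v} {q} ≤k (eq , _) =
    subst (_≤ k) (sym eq) ≤k , ≤-reflexive (trans eq (cong L (sym (nbr-rev v q))))

  open⇒good : ∀ {v p} → L v ≤ k → Open v p → Good (v , p)
  open⇒good ≤k (eq , _) = ≤k , ≤-reflexive (sym eq)

  open-flip : ∀ {v p} → On v → Open v p → Open (nbr v p) (rev v p)
  open-flip {v} {p} on (eq , _) =
    trans (cong L (nbr-rev v p)) (sym eq) , subst On (sym (nbr-rev v p)) on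

  data Tail : Dart → ℕ → Fin n → Set where
    stop : ∀ {d} → (∀ q → ¬ Continues d q) → Tail d 0 (head d)
    more   : ∀ {d q a w} → Continues d q → Tail (flip (head d , q)) a w → Tail d (suc a) w

  data Long : Dart → ℕ → Set where
    []  : ∀ {d} → Long d 0
    _∷_ : ∀ {d q m} → Continues d q → Long (flip (head d , q)) m → Long d (suc m)

  tail⇒long : ∀ {d a w} → Tail d a w → Long d a
  tail⇒long (stop _)  = []
  tail⇒long (more c t) = c ∷ tail⇒long t

  long-≤ : ∀ {d m m′} → m ≤ m′ → Long d m′ → Long d m
  long-≤ z≤n      _       = []
  long-≤ (s≤s le) (c ∷ l) = c ∷ long-≤ le l

  tail-long-≤ : ∀ {d a w m} → Good d → Tail d a w → Long d m → m ≤ a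
  tail-long-≤ _ _ [] = z≤n
  tail-long-≤ g (stop none) (c ∷ _) = contradiction c (none _)
  tail-long-≤ g (more c t) (c′ ∷ l) with continues-unique g c c′
  ... | refl = s≤s (tail-long-≤ (good-flip (proj₁ g) (proj₁ c)) t l)

  tail-unique : ∀ {d a w a′ w′} → Good d → Tail d a w → Tail d a′ w′ → a ≡ a′ × w ≡ w′
  tail-unique g (stop _) (stop _) = refl , refl
  tail-unique g (stop none) (more c _) = contradiction c (none _)
  tail-unique g (more c _) (stop none) = contradiction c (none _)
  tail-unique g (more c t) (more c′ t′) with continues-unique g c c′
  ... | refl with tail-unique (good-flip (proj₁ g) (proj₁ c)) t t′
  ...   | refl , refl = refl , refl

  next : Dart → Dart
  next d with continues? d
  ... | yes (q , _) = flip (head d , q)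
  -- At the end of a path the walk stays put; `Long` and `Tail` tell for how many steps it moves.
  ... | no _        = d

  next-≡ : ∀ {d q} → Good d → Continues d q → next d ≡ flip (head d , q)
  next-≡ {d} g c with continues? d
  ... | yes (r , c′) = cong (λ r → flip (head d , r)) (continues-unique g c′ c)
  ... | no none      = contradiction (_ , c) none

  walk : ℕ → Dart → Dart
  walk zero    d = d
  walk (suc j) d = walk j (next d)

  walk-suc : ∀ j d → walk (suc j) d ≡ next (walk j d)
  walk-suc zero    d = refl
  walk-suc (suc j) d = walk-suc j (next d)

  walk-good : ∀ {d m j} → Good d → Long d m → j ≤ m → Good (walk j d)
  walk-good {j = zero} g _ _ = g
  walk-good {j = suc j} g (c ∷ l) (s≤s le) rewrite next-≡ g c =
    walk-good {j = j} (good-flip (proj₁ g) (proj₁ c)) l le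

  walk-L : ∀ {d m j} → Good d → Long d m → j ≤ m → L (head (walk j d)) ≡ L (head d)
  walk-L {j = zero} g _ _ = refl
  walk-L {j = suc j} g (c ∷ l) (s≤s le) rewrite next-≡ g c =
    trans (walk-L {j = j} (good-flip (proj₁ g) (proj₁ c)) l le) (proj₁ (proj₁ c))

  walk-On : ∀ {d m j} → On (head d) → Good d → Long d m → j ≤ m → On (head (walk j d))
  walk-On {j = zero} on _ _ _ = on
  walk-On {j = suc j} on g (c ∷ l) (s≤s le) rewrite next-≡ g c =
    walk-On {j = j} (proj₂ (proj₁ c)) (good-flip (proj₁ g) (proj₁ c)) l le

  walk-continues : ∀ {d m j} → Good d → Long d m → j < m → ∃ (Continues (walk j d))
  walk-continues {j = zero} g (c ∷ _) _ = _ , c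
  walk-continues {j = suc j} g (c ∷ l) (s≤s le) rewrite next-≡ g c =
    walk-continues {j = j} (good-flip (proj₁ g) (proj₁ c)) l le

  tail-end : ∀ {d a w} → Good d → Tail d a w → head (walk a d) ≡ w
  tail-end g (stop _) = refl
  tail-end {a = suc a} g (more c t) rewrite next-≡ g c = tail-end (good-flip (proj₁ g) (proj₁ c)) t

  tail-next : ∀ {d q} → Good d → Continues d q → tail (next d) ≡ head d
  tail-next {d} g c rewrite next-≡ g c = tail-flip (head d , _)

  -- The tail of the successor is the common head of both darts, and its head fixes the port by
  -- which they go on. Only one upward port is left there, so both arrived through it.
  next-injective : ∀ {d e q r} → Good d → Good e → Continues d q → Continues e r →
                   next d ≡ next e → d ≡ e
  next-injective {v , p} {v′ , p′} {q} {r} gd ge c c′ eq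
    with trans (sym (tail-next gd c)) (trans (cong tail eq) (tail-next ge c′))
  ... | refl with nbr-inj v {q} {r} (trans (sym (cong head (next-≡ gd c))) (trans (cong head eq) (cong head (next-≡ ge c′))))
  ... | refl with p Fin.≟ p′
  ... | yes p≡p′ = cong (v ,_) p≡p′
  ... | no  p≢p′ = contradiction
    (ups-≤2 (proj₁ gd) (proj₂ gd) (proj₂ ge) (≤-reflexive (sym (proj₁ (proj₁ c)))) p≢p′ (proj₂ c ∘ sym))
    (proj₂ c′ ∘ sym)

  -- Counting from the tail includes the edge of the starting dart: m steps show m + 2 nodes.
  visited : Dart → ℕ → Fin n
  visited d zero    = tail d
  visited d (suc j) = head (walk j d)

  module _ (acyclic : ¬ Cycle) where

    -- `Continues` excludes the port of arrival, so the walk never backtracks.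
    visited-≢ : ∀ {d m} → Good d → Long d m → ∀ {i j} → i < j → j ≤ suc m → visited d i ≢ visited d j
    visited-≢ {d} {m} g l {i} {j} i<j j≤ with m≤n⇒∃[o]m+o≡n i<j
    ... | o , refl = subst (λ j → visited d i ≢ visited d j) (+-suc i o)
        (Acyclic.nonbacktracking-≢ G acyclic (visited d) (suc m) adj nb o i (≤-trans (≤-reflexive (+-suc i o)) j≤))
      where
      tail-walk : ∀ j → j ≤ m → tail (walk j d) ≡ visited d j
      tail-walk zero _ = refl
      tail-walk (suc j) le rewrite walk-suc j d =
        tail-next (walk-good {j = j} g l (<⇒≤ le)) (proj₂ (walk-continues {j = j} g l le))
      step : ∀ j (lt : j < m) → head (walk (suc j) d) ≡ nbr (head (walk j d)) (proj₁ (walk-continues {j = j} g l lt))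
      step j lt rewrite walk-suc j d =
        cong head (next-≡ (walk-good {j = j} g l (<⇒≤ lt)) (proj₂ (walk-continues {j = j} g l lt)))
      adj : ∀ i → i < suc m → Adj (visited d i) (visited d (suc i))
      adj zero _ = rev _ _ , tail-flip d
      adj (suc i) (s≤s lt) = _ , sym (step i lt)
      nb : ∀ i → 2 + i ≤ suc m → visited d i ≢ visited d (2 + i)
      nb i (s≤s lt) eq = proj₂ (proj₂ (walk-continues {j = i} g l lt))
        (nbr-inj _ (sym (trans (tail-walk i (<⇒≤ lt)) (trans eq (step i lt)))))

    -- Moving the edge that separates the two tails to the end w of the first one.
    shift : ∀ {v p a b w w′} → L v ≤ k → On v → Open v p →
            Tail (v , p) a w → Tail (flip (v , p)) b w′ →
            Σ[ d ∈ Dart ] tail d ≡ w × Good d × On (head d) × L (head d) ≡ L v × Tail d (a + b) w′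
    shift {v} {p} ≤k on op (stop _) t′ =
      flip (v , p) , tail-flip (v , p) , good-flip ≤k op , proj₂ op , proj₁ op , t′
    shift {v} {p} {suc a} {b} {w′ = w′} ≤k on op (more {q = r} c t) t′
      with shift {nbr v r} {rev v r} {a} {suc b} (subst (_≤ k) (sym (proj₁ (proj₁ c))) ≤k)
             (proj₂ (proj₁ c)) (open-flip on (proj₁ c)) t
             (subst (λ d → Tail d (suc b) _) (sym (flip-flip (v , r))) (more (op , proj₂ c ∘ sym) t′))
    ... | d , eq , g , on′ , Leq , t″ =
      d , eq , g , on′ , trans Leq (proj₁ (proj₁ c)) , subst (λ m → Tail d m w′) (+-suc a b) t″

    -- After `shift` both ends lie on a single walk, `w` as the tail of its first dart and `w′` as
    -- its last head, and a walk repeats no node.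
    ends-≢ : ∀ {v p a b w w′} → L v ≤ k → On v → Open v p →
             Tail (v , p) a w → Tail (flip (v , p)) b w′ → w ≢ w′
    ends-≢ {a = a} {b} ≤k on op t t′ w≡w′ with shift ≤k on op t t′
    ... | d , eq , g , _ , _ , t″ =
      visited-≢ g (tail⇒long t″) {0} {suc (a + b)} (s≤s z≤n) ≤-refl
        (trans eq (trans w≡w′ (sym (tail-end g t″))))

-- Labels and the local decision rules

D? : (l : Label) → Dec (l ≡ D)
D? W = no λ ()
D? B = no λ ()
D? E = no λ ()
D? D = yes refl

parity : ℕ → Label
parity 0             = W
parity 1             = B
parity (suc (suc n)) = parity n

parity-suc : ∀ n → parity n ≢ parity (suc n)
parity-suc 0             ()
parity-suc 1             ()
parity-suc (suc (suc n)) = parity-suc n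

parity-WB : ∀ n → parity n ≡ W ⊎ parity n ≡ B
parity-WB 0             = inj₁ refl
parity-WB 1             = inj₂ refl
parity-WB (suc (suc n)) = parity-WB n

Exempting : Maybe Label → Set
Exempting m = ∃[ l ] m ≡ just l × l ≢ D

exempting? : ∀ m → Dec (Exempting m)
exempting? nothing  = no λ ()
exempting? (just l) = map′ (λ ≢D → l , refl , ≢D) (λ { (_ , refl , ≢D) → ≢D }) (¬? (D? l))

-- The length of a path and the identifier of its last node.
Info : Set
Info = ℕ × ℕ

Heard : Maybe Info → Set
Heard m = ∃[ i ] m ≡ just i

heard? : ∀ m → Dec (Heard m)
heard? nothing  = no λ ()
heard? (just i) = yes (i , refl)

payload : Maybe Info → Info
payload = fromMaybe (0 , 0)

extend : Info → Info
extend (a , y) = suc a , y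

-- The first pair measures from the node itself to the end x, the second from its neighbour on the
-- other side to the end y; hence the node is at distance `suc b` from y.
hue : Info → Info → Label
hue (a , x) (b , y) with x <? y
... | yes _ = parity a
... | no  _ = parity (suc b)

hue-WB : ∀ s f → hue s f ≡ W ⊎ hue s f ≡ B
hue-WB (a , x) (b , y) with x <? y
... | yes _ = parity-WB a
... | no  _ = parity-WB (suc b)

module _ {d} (ident : ℕ) (far : Fin d → Maybe Info) where

  other? : ∀ p → Dec (∃[ q ] Heard (far q) × q ≢ p)
  other? p = any? λ q → heard? (far q) ×-dec ¬? (q Fin.≟ p)

  -- What goes out through p stems from another port, so claims move along the path and are not
  -- echoed. A node that hears nothing elsewhere takes itself for an end of the path.
  side : Fin d → Info
  side p with other? p
  ... | yes (q , _) = extend (payload (far q))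
  ... | no  _       = 0 , ident

  judge : ℕ → Info → Info → Label
  judge θ s f with proj₁ s + proj₁ f <? θ
  ... | yes _ = hue s f
  ... | no  _ = D

  -- Any port on which something is heard will do: `verdict-at` shows that the choice does not
  -- affect the answer. If there is none, the path is a single node.
  colour : ℕ → Label
  colour θ with any? (heard? ∘ far)
  ... | yes (p , _) = judge θ (side p) (payload (far p))
  ... | no  _       = W

  side-spec : ∀ p → (side p ≡ (0 , ident) × (∀ q → Heard (far q) → q ≡ p))
                  ⊎ (∃[ q ] q ≢ p × ∃[ i ] far q ≡ just i × side p ≡ extend i)
  side-spec p with other? p
  ... | yes (q , (i , eq) , q≢p) = inj₂ (q , q≢p , i , eq , cong (extend ∘ payload) eq)
  ... | no none = inj₁ (refl , λ q h → lemma q h (q Fin.≟ p))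
    where
    lemma : ∀ q → Heard (far q) → Dec (q ≡ p) → q ≡ p
    lemma q h (yes eq) = eq
    lemma q h (no neq) = contradiction (q , h , neq) none

  judge-spec : ∀ θ s f → (proj₁ s + proj₁ f < θ × judge θ s f ≡ hue s f)
                       ⊎ (θ ≤ proj₁ s + proj₁ f × judge θ s f ≡ D)
  judge-spec θ s f with proj₁ s + proj₁ f <? θ
  ... | yes lt = inj₁ (lt , refl)
  ... | no ¬lt = inj₂ (≮⇒≥ ¬lt , refl)

  colour-spec : ∀ θ → (colour θ ≡ W × (∀ p → ¬ Heard (far p)))
                    ⊎ (∃[ p ] ∃[ i ] far p ≡ just i × colour θ ≡ judge θ (side p) i)
  colour-spec θ with any? (heard? ∘ far)
  ... | yes (p , i , eq) = inj₂ (p , i , eq , cong (judge θ (side p) ∘ payload) eq)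
  ... | no none = inj₁ (refl , λ p h → none (p , h))

  colour≢E : ∀ θ → colour θ ≢ E
  colour≢E θ eq with colour-spec θ
  ... | inj₁ (eq′ , _) = contradiction (trans (sym eq′) eq) λ ()
  ... | inj₂ (p , i , _ , eq′) with judge-spec θ (side p) i
  ...   | inj₂ (_ , eq″) = contradiction (trans (sym eq″) (trans (sym eq′) eq)) λ ()
  ...   | inj₁ (_ , eq″) with hue-WB (side p) i
  ...     | inj₁ eq‴ = contradiction (trans (sym eq‴) (trans (sym eq″) (trans (sym eq′) eq))) λ ()
  ...     | inj₂ eq‴ = contradiction (trans (sym eq‴) (trans (sym eq″) (trans (sym eq′) eq))) λ ()

module _ {a b c e} {A : Set a} {B : Set b} {C : Set c} {F : Set e} where

  -- The four conditions stand for: levels still being computed, top level, a lower neighbour has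
  -- exempted the node, deadline reached. Exemption comes before the deadline.
  decide : Dec A → Dec B → Dec C → Dec F → Label → Maybe Label
  decide (yes _) _       _       _       _ = nothing
  decide (no _)  (yes _) _       _       _ = just E
  decide (no _)  (no _)  (yes _) _       _ = just E
  decide (no _)  (no _)  (no _)  (yes _) l = just l
  decide (no _)  (no _)  (no _)  (no _)  _ = nothing

  decide-wait : ∀ da {db dc df l} → A → decide da db dc df l ≡ nothing
  decide-wait (yes _) _ = refl
  decide-wait (no ¬a) a = contradiction a ¬a

  decide-top : ∀ da db {dc df l} → ¬ A → B → decide da db dc df l ≡ just E
  decide-top (yes a) _       ¬a _ = contradiction a ¬a
  decide-top (no _)  (yes _) _  _ = refl
  decide-top (no _)  (no ¬b) _  b = contradiction b ¬b

  decide-low : ∀ da db dc df {l} → ¬ A → ¬ B →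
      (C × decide da db dc df l ≡ just E)
    ⊎ (¬ C × F × decide da db dc df l ≡ just l)
    ⊎ (¬ C × ¬ F × decide da db dc df l ≡ nothing)
  decide-low (yes a) _       _       _       ¬a _  = contradiction a ¬a
  decide-low (no _)  (yes b) _       _       _  ¬b = contradiction b ¬b
  decide-low (no _)  (no _)  (yes c) _       _  _  = inj₁ (c , refl)
  decide-low (no _)  (no _)  (no ¬c) (yes f) _  _  = inj₂ (inj₁ (¬c , f , refl))
  decide-low (no _)  (no _)  (no ¬c) (no ¬f) _  _  = inj₂ (inj₂ (¬c , ¬f , refl))

module _ {a b c} {A : Set a} {B : Set b} {C : Set c} where

  refine : Dec A → Dec B → Dec C → ℕ → ℕ → ℕ
  refine (yes _) (yes _) (yes _) x _ = x
  refine _       _       _       _ y = y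

  refine-yes : ∀ {x y} da db dc → A → B → C → refine da db dc x y ≡ x
  refine-yes (yes _) (yes _) (yes _) _ _ _ = refl
  refine-yes (no ¬a) _       _       a _ _ = contradiction a ¬a
  refine-yes (yes _) (no ¬b) _       _ b _ = contradiction b ¬b
  refine-yes (yes _) (yes _) (no ¬c) _ _ c = contradiction c ¬c

  refine-no : ∀ {x y} da db dc → (A → B → ¬ C) → refine da db dc x y ≡ y
  refine-no (yes a) (yes b) (yes c) ¬abc = contradiction c (¬abc a b)
  refine-no (yes _) (yes _) (no _)  _ = refl
  refine-no (yes _) (no _)  _       _ = refl
  refine-no (no _)  _       _       _ = refl

-- The protocol

record LocalState (d : ℕ) : Set where
  field
    clock size ident lvl : ℕ
    levels : Fin d → ℕ
    -- what the running neighbours of the same level last sent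
    far    : Fin d → Maybe Info
    out    : Maybe Label
open LocalState

Message : Set
Message = ℕ × Info

heardLevel : Packet Message Label → ℕ
heardLevel (running (l , _)) = l
heardLevel (terminated _)    = 0

heardInfo : Packet Message Label → Maybe Info
heardInfo (running (_ , i)) = just i
heardInfo (terminated _)    = nothing

announced : Packet Message Label → Maybe Label
announced (running _)    = nothing
announced (terminated l) = just l

occurrences : ∀ {d} → (Fin d → ℕ) → ℕ → ℕ
occurrences f c = ∣ tabulate (λ p → does (f p ≟ c)) ∣

module Protocol (k : ℕ) (threshold : ℕ → ℕ → ℕ) where

  -- threshold n j is the length bound γ of level j + 1.
  deadline : ℕ → ℕ → ℕ
  deadline n zero    = suc k
  deadline n (suc j) = deadline n j + (3 + threshold n j)

  module _ {d} (s : LocalState d) (ms : Vec (Packet Message Label) d) where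

    -- A terminated neighbour shows nothing but its label, so levels are recorded while everybody
    -- still runs. At clock k the levels being sent are final, and they are kept from then on.
    newLevels : Fin d → ℕ
    newLevels p with clock s ≤? k
    ... | yes _ = heardLevel (lookup ms p)
    ... | no  _ = levels s p

    -- A terminated neighbour of the same level is treated as absent: this is how exempt nodes cut
    -- their level into paths.
    newFar : Fin d → Maybe Info
    newFar p with newLevels p ≟ lvl s
    ... | yes _ = heardInfo (lookup ms p)
    ... | no  _ = nothing

    newOut : Maybe Label
    newOut = decide (clock s <? k) (lvl s ≟ suc k)
      (any? λ p → (newLevels p <? lvl s) ×-dec exempting? (announced (lookup ms p)))
      (suc (clock s) ≟ deadline (size s) (lvl s))
      (colour (ident s) newFar (threshold (size s) (pred (lvl s))))

  algorithm : Algorithm Label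
  algorithm = record
    { Message = Message
    ; State   = LocalState
    ; init    = λ n _ i d → record
      { clock = 0 ; size = n ; ident = i ; lvl = 1
      ; levels = λ _ → 0 ; far = λ _ → nothing ; out = nothing }
    ; send    = λ s p → lvl s , side (ident s) (far s) p
    ; step    = λ s ms → record
      { clock  = suc (clock s)
      ; size   = size s
      ; ident  = ident s
      -- At clock t the nodes that survived t peeling steps have `lvl` t + 1, so three neighbours at
      -- that level mean degree above 2 in the remaining forest.
      ; lvl    = refine (clock s <? k) (lvl s ≟ suc (clock s))
                   (3 ≤? occurrences (newLevels s ms) (suc (clock s))) (2 + clock s) (lvl s)
      ; levels = newLevels s ms
      ; far    = newFar s ms
      ; out    = newOut s ms
      }
    ; output  = out
    }

  -- Learning the levels

  module Run {Δ c n : ℕ} (I : Instance Δ c n) where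
    open Instance I hiding (ident)
    open Instance I using () renaming (ident to identity)
    open Levels graph using (level-suc-∈; level-suc-∉; remaining-suc⁻; remaining-suc⁺; level>⇒remaining; remaining⇒level>; level≤)

    L : Fin n → ℕ
    L = level graph k

    opaque
      state : ℕ → ∀ v → LocalState (deg v)
      state = stateAfter algorithm I

    label : ℕ → Fin n → Maybe Label
    label t v = out (state t v)

    packet : ∀ t v → Fin (deg v) → Packet Message Label
    packet t v p = transmit algorithm I (state t (nbr v p)) (rev v p)

    inbox : ∀ t v → Vec (Packet Message Label) (deg v)
    inbox t v = tabulate (packet t v)

    opaque
      unfolding state

      stateAfter≡state : ∀ t v → stateAfter algorithm I t v ≡ state t v
      stateAfter≡state t v = refl

      state-zero : ∀ v → state 0 v ≡ Algorithm.init algorithm n maxDegree (identity v) (deg v)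
      state-zero v = refl

      state-running : ∀ {t v} → label t v ≡ nothing →
                      state (suc t) v ≡ Algorithm.step algorithm (state t v) (inbox t v)
      state-running eq rewrite eq = refl

      state-frozen : ∀ {t v l} → label t v ≡ just l → state (suc t) v ≡ state t v
      state-frozen eq rewrite eq = refl

    packet-running : ∀ {t v p} → label t (nbr v p) ≡ nothing →
      packet t v p ≡ running (lvl (state t (nbr v p)) ,
                              side (ident (state t (nbr v p))) (far (state t (nbr v p))) (rev v p))
    packet-running eq rewrite eq = refl

    packet-terminated : ∀ {t v p l} → label t (nbr v p) ≡ just l → packet t v p ≡ terminated l
    packet-terminated eq rewrite eq = refl

    announced-packet : ∀ t v p → announced (lookup (inbox t v) p) ≡ label t (nbr v p)
    announced-packet t v p rewrite lookup∘tabulate (packet t v) p with label t (nbr v p) in eq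
    ... | nothing = refl
    ... | just _  = refl

    newLevels-early : ∀ {t v p} → clock (state t v) ≤ k → label t (nbr v p) ≡ nothing →
                      newLevels (state t v) (inbox t v) p ≡ lvl (state t (nbr v p))
    newLevels-early {t} {v} {p} ≤k eq with clock (state t v) ≤? k
    ... | yes _ = cong heardLevel (trans (lookup∘tabulate (packet t v) p) (packet-running {t} {v} {p} eq))
    ... | no ≰k = contradiction ≤k ≰k

    newLevels-late : ∀ {t v p} → k < clock (state t v) →
                     newLevels (state t v) (inbox t v) p ≡ levels (state t v) p
    newLevels-late {t} {v} {p} >k with clock (state t v) ≤? k
    ... | yes ≤k = contradiction ≤k (<⇒≱ >k)
    ... | no _   = refl

    record EarlyAt (t : ℕ) (v : Fin n) (s : LocalState (deg v)) : Set where
      field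
        clock≡ : clock s ≡ t
        size≡  : size s ≡ n
        ident≡ : ident s ≡ identity v
        lvl≡   : lvl s ≡ level graph t v
        out≡   : out s ≡ nothing

    Early : ℕ → Fin n → Set
    Early t v = EarlyAt t v (state t v)

    -- The invariant is that after t rounds `lvl` is the level of the peeling cut off after t steps.
    -- In it, level t + 1 characterises the members of `remaining t`, so each node can count its
    -- degree among them from the messages.
    early : ∀ {t} → t ≤ k → ∀ v → Early t v
    early {zero}  _   v = subst (EarlyAt 0 v) (sym (state-zero v)) record { clock≡ = refl ; size≡ = refl ; ident≡ = refl ; lvl≡ = refl ; out≡ = refl }
    early {suc t} t<k v = subst (EarlyAt (suc t) v) (sym (state-running {t} {v} out≡)) record
      { clock≡ = cong suc clock≡
      ; size≡  = size≡
      ; ident≡ = ident≡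
      ; lvl≡   = lvl-step (v ∈? remaining graph (suc t))
      ; out≡   = decide-wait (clock (state t v) <? k) (subst (_< k) (sym clock≡) t<k)
      }
      where
      ih : ∀ u → Early t u
      ih = early (<⇒≤ t<k)
      open EarlyAt (ih v)
      s = state t v
      s′ = Algorithm.step algorithm s (inbox t v)
      clock≤k : clock s ≤ k
      clock≤k = subst (_≤ k) (sym clock≡) (<⇒≤ t<k)
      same : ∀ p → does (newLevels s (inbox t v) p ≟ suc (clock s)) ≡ lookup (remaining graph t) (nbr v p)
      same p rewrite newLevels-early {t} {v} {p} clock≤k (EarlyAt.out≡ (ih (nbr v p)))
                   | EarlyAt.lvl≡ (ih (nbr v p)) | clock≡
        with nbr v p ∈? remaining graph t
      ... | yes u∈ = trans (dec-true (level graph t (nbr v p) ≟ suc t)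
                       (≤-antisym (level≤ t _) (remaining⇒level> ≤-refl u∈))) (sym ([]=⇒lookup u∈))
      ... | no  u∉ = trans (dec-false (level graph t (nbr v p) ≟ suc t)
                       (λ eq → u∉ (level>⇒remaining ≤-refl (≤-reflexive (sym eq)))))
                       (sym (not-true λ eq → u∉ (lookup⇒[]= _ _ eq)))
        where
        not-true : ∀ {b} → b ≢ true → b ≡ false
        not-true {true}  ≢ = contradiction refl ≢
        not-true {false} _ = refl
      occurrences≡ : occurrences (newLevels s (inbox t v)) (suc (clock s)) ≡ degreeIn graph (remaining graph t) v
      occurrences≡ = cong ∣_∣ (tabulate-cong same)
      lvl-step : Dec (v ∈ remaining graph (suc t)) → lvl s′ ≡ level graph (suc t) v
      lvl-step (yes v∈) = trans
        (refine-yes (clock s <? k) (lvl s ≟ suc (clock s)) (3 ≤? occurrences (newLevels s (inbox t v)) (suc (clock s)))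
          (subst (_< k) (sym clock≡) t<k)
          (trans lvl≡ (trans (≤-antisym (level≤ t v) (remaining⇒level> ≤-refl (proj₁ (remaining-suc⁻ {t} v∈)))) (cong suc (sym clock≡))))
          (subst (3 ≤_) (sym occurrences≡) (≰⇒> (proj₂ (remaining-suc⁻ {t} v∈)))))
        (trans (cong (2 +_) clock≡) (sym (level-suc-∈ v∈)))
      lvl-step (no v∉) = trans
        (refine-no (clock s <? k) (lvl s ≟ suc (clock s)) (3 ≤? occurrences (newLevels s (inbox t v)) (suc (clock s)))
          λ _ lvl-eq three≤ → v∉ (remaining-suc⁺ {t}
            (level>⇒remaining ≤-refl (≤-reflexive (sym (trans (sym lvl≡) (trans lvl-eq (cong suc clock≡))))))
            (<⇒≱ (subst (3 ≤_) occurrences≡ three≤))))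
        (trans lvl≡ (sym (level-suc-∉ v∉)))

    -- The clock of a terminated node stands still, hence the condition in `clock≡`. The final
    -- levels are sent at time k and stored at time k + 1, hence the one in `levels≡`.
    record LateAt (t : ℕ) (v : Fin n) (s : LocalState (deg v)) : Set where
      field
        clock≡  : out s ≡ nothing → clock s ≡ t
        size≡   : size s ≡ n
        ident≡  : ident s ≡ identity v
        lvl≡    : lvl s ≡ L v
        levels≡ : k < t → ∀ p → levels s p ≡ L (nbr v p)

    Late : ℕ → Fin n → Set
    Late t v = LateAt t v (state t v)

    newLevels≡ : ∀ {t v} → k ≤ t → Late t v → label t v ≡ nothing →
                 ∀ p → newLevels (state t v) (inbox t v) p ≡ L (nbr v p)
    newLevels≡ {t} {v} k≤t late eq p with m≤n⇒m<n∨m≡n k≤t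
    ... | inj₁ k<t = trans (newLevels-late {t} {v} (subst (k <_) (sym (LateAt.clock≡ late eq)) k<t)) (LateAt.levels≡ late k<t p)
    ... | inj₂ refl = trans (newLevels-early {t} {v} {p} (≤-reflexive (LateAt.clock≡ late eq)) (EarlyAt.out≡ e)) (EarlyAt.lvl≡ e)
      where e = early ≤-refl (nbr v p)

    late : ∀ {t} → k ≤ t → ∀ v → Late t v
    late {t} k≤t v with m≤n⇒m<n∨m≡n k≤t
    ... | inj₂ refl = record { clock≡ = λ _ → clock≡ ; size≡ = size≡ ; ident≡ = ident≡ ; lvl≡ = lvl≡
                             ; levels≡ = λ k<k → contradiction k<k (n≮n k) }
      where open EarlyAt (early ≤-refl v)
    late {suc t} _ v | inj₁ (s≤s k≤t) = advanced (label t v) refl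
      where
      open LateAt (late k≤t v)
      s = state t v
      advanced : ∀ m → label t v ≡ m → Late (suc t) v
      advanced nothing eq = subst (LateAt (suc t) v) (sym (state-running {t} {v} eq)) record
        { clock≡  = λ _ → cong suc (clock≡ eq)
        ; size≡   = size≡
        ; ident≡  = ident≡
        ; lvl≡    = trans (refine-no (clock s <? k) (lvl s ≟ suc (clock s))
                             (3 ≤? occurrences (newLevels s (inbox t v)) (suc (clock s)))
                             λ clock<k → contradiction (subst (_< k) (clock≡ eq) clock<k) (≤⇒≯ k≤t)) lvl≡
        ; levels≡ = λ _ → newLevels≡ k≤t (late k≤t v) eq
        }
      advanced (just _) eq = subst (LateAt (suc t) v) (sym (state-frozen {t} {v} eq)) record
        { clock≡  = λ eq′ → contradiction (trans (sym eq) eq′) λ ()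
        ; size≡   = size≡
        ; ident≡  = ident≡
        ; lvl≡    = lvl≡
        ; levels≡ = λ _ → levels≡ k<t
        }
        where
        k<t : k < t
        k<t = ≤∧≢⇒< k≤t λ { refl → contradiction (trans (sym eq) (EarlyAt.out≡ (early ≤-refl v))) λ () }

-- When a node terminates, and with which label

E? : (l : Label) → Dec (l ≡ E)
E? W = no λ ()
E? B = no λ ()
E? E = yes refl
E? D = no λ ()

module Outcome (k : ℕ) (threshold : ℕ → ℕ → ℕ) {Δ c n : ℕ} (I : Instance Δ c n) where
  open Instance I hiding (ident)
  open Instance I using () renaming (ident to identity)
  open Protocol k threshold
  open Run I using (L; state; label; packet; inbox; state-running; state-frozen; packet-running; packet-terminated;
                    announced-packet; early; late; newLevels≡; module EarlyAt; module LateAt)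
  open Levels graph using (level≥1; level≤)

  T : ℕ → ℕ
  T = deadline n

  T-mono : ∀ {i j} → i ≤ j → T i ≤ T j
  T-mono {i} {j} i≤j with m≤n⇒∃[o]m+o≡n i≤j
  ... | o , refl = go o
    where
    go : ∀ o → T i ≤ T (i + o)
    go zero = ≤-reflexive (cong T (sym (+-identityʳ i)))
    go (suc o) rewrite +-suc i o = ≤-trans (go o) (m≤m+n _ _)

  k<T : ∀ i → k < T i
  k<T i = T-mono {0} {i} z≤n

  label-early : ∀ {t v} → t ≤ k → label t v ≡ nothing
  label-early t≤k = EarlyAt.out≡ (early t≤k _)

  just⇒late : ∀ {t v l} → label t v ≡ just l → k < t
  just⇒late {t} {v} eq with k <? t
  ... | yes k<t = k<t
  ... | no  k≮t = contradiction (trans (sym eq) (label-early (≮⇒≥ k≮t))) λ ()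

  label-mono : ∀ {t t′ v l} → t ≤ t′ → label t v ≡ just l → label t′ v ≡ just l
  label-mono {t} {t′} {v} {l} t≤t′ eq with m≤n⇒∃[o]m+o≡n t≤t′
  ... | o , refl = go o
    where
    go : ∀ o → label (t + o) v ≡ just l
    go zero = trans (cong (λ t → label t v) (+-identityʳ t)) eq
    go (suc o) = trans (cong (λ t → label t v) (+-suc t o))
                   (trans (cong out (state-frozen {t + o} {v} (go o))) (go o))

  label-top : ∀ {v} → L v ≡ suc k → label (suc k) v ≡ just E
  label-top {v} eq = trans (cong out (state-running {k} {v} (label-early ≤-refl)))
    (decide-top (clock (state k v) <? k) (lvl (state k v) ≟ suc k)
      (λ lt → <-irrefl (EarlyAt.clock≡ e) lt) (trans (EarlyAt.lvl≡ e) eq))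
    where e = early ≤-refl v

  Exempt : ℕ → Fin n → Set
  Exempt t v = ∃[ p ] L (nbr v p) < L v × Exempting (label t (nbr v p))

  localColour : ℕ → Fin n → Label
  localColour t v = colour (identity v) (far (state t v)) (threshold n (pred (L v)))

  label-step : ∀ {t v} → L v ≤ k → k ≤ t → label t v ≡ nothing →
      (Exempt t v × label (suc t) v ≡ just E)
    ⊎ (¬ Exempt t v × suc t ≡ T (L v) × label (suc t) v ≡ just (localColour (suc t) v))
    ⊎ (¬ Exempt t v × suc t ≢ T (L v) × label (suc t) v ≡ nothing)
  label-step {t} {v} Lv≤k k≤t eq
    rewrite state-running {t} {v} eq
    with late k≤t v
  ... | lt rewrite sym (LateAt.ident≡ lt) = result
    where
    s  = state t v
    ms = inbox t v
    open LateAt lt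
    levels′ : ∀ p → newLevels s ms p ≡ L (nbr v p)
    levels′ = newLevels≡ k≤t lt eq
    C = ∃[ p ] newLevels s ms p < lvl s × Exempting (announced (lookup ms p))
    to : C → Exempt t v
    to (p , lower , ex) = p , subst₂ _<_ (levels′ p) lvl≡ lower , subst Exempting (announced-packet t v p) ex
    from : Exempt t v → C
    from (p , lower , ex) = p , subst₂ _<_ (sym (levels′ p)) (sym lvl≡) lower
                              , subst Exempting (sym (announced-packet t v p)) ex
    time : suc (clock s) ≡ deadline (size s) (lvl s) → suc t ≡ T (L v)
    time eq′ = trans (cong suc (sym (clock≡ eq))) (trans eq′ (cong₂ deadline size≡ lvl≡))
    time⁻ : suc t ≡ T (L v) → suc (clock s) ≡ deadline (size s) (lvl s)
    time⁻ eq′ = trans (cong suc (clock≡ eq)) (trans eq′ (cong₂ deadline (sym size≡) (sym lvl≡)))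
    col : colour (ident s) (newFar s ms) (threshold (size s) (pred (lvl s)))
        ≡ colour (ident s) (newFar s ms) (threshold n (pred (L v)))
    col = cong (colour (ident s) (newFar s ms)) (cong₂ (λ a b → threshold a (pred b)) size≡ lvl≡)
    result : _
    result with decide-low (clock s <? k) (lvl s ≟ suc k)
                  (any? λ p → (newLevels s ms p <? lvl s) ×-dec exempting? (announced (lookup ms p)))
                  (suc (clock s) ≟ deadline (size s) (lvl s))
                  {colour (ident s) (newFar s ms) (threshold (size s) (pred (lvl s)))}
                  (λ <k → <⇒≱ (subst (_< k) (clock≡ eq) <k) k≤t)
                  (λ top → 1+n≰n (subst (_≤ k) (trans (sym lvl≡) top) Lv≤k))
    ... | inj₁ (ex , o)             = inj₁ (to ex , o)
    ... | inj₂ (inj₁ (¬ex , f , o)) = inj₂ (inj₁ (¬ex ∘ from , time f , trans o (cong just col)))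
    ... | inj₂ (inj₂ (¬ex , f , o)) = inj₂ (inj₂ (¬ex ∘ from , f ∘ time⁻ , o))

  L-suc : ∀ v → ∃[ j ] L v ≡ suc j
  L-suc v with L v | level≥1 k v
  ... | suc j | _ = j , refl

  T-pred : ∀ {v j} → L v ≡ suc j → T (L v) ≡ suc (T j + (2 + threshold n j))
  T-pred {j = j} eq = trans (cong T eq) (+-suc (T j) _)

  label-deadline : ∀ {v} → L v ≤ k → ∃[ l ] label (T (L v)) v ≡ just l
  label-deadline {v} Lv≤k with L-suc v
  ... | j , eq = subst (λ t → ∃[ l ] label t v ≡ just l) (sym (T-pred eq)) (go (label t v) refl)
    where
    t = T j + (2 + threshold n j)
    k≤t : k ≤ t
    k≤t = ≤-trans (<⇒≤ (k<T j)) (m≤m+n _ _)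
    go : ∀ m → label t v ≡ m → ∃[ l ] label (suc t) v ≡ just l
    go (just l) eq′ = l , label-mono (n≤1+n t) eq′
    go nothing eq′ with label-step Lv≤k k≤t eq′
    ... | inj₁ (_ , o)              = _ , o
    ... | inj₂ (inj₁ (_ , _ , o))   = _ , o
    ... | inj₂ (inj₂ (_ , neq , _)) = contradiction (sym (T-pred eq)) neq

  labelled : ∀ v → ∃[ l ] label (T (L v)) v ≡ just l
  labelled v with m≤n⇒m<n∨m≡n (level≤ k v)
  ... | inj₁ (s≤s Lv≤k) = label-deadline Lv≤k
  ... | inj₂ top        = E , label-mono (k<T (L v)) (label-top top)

  lab : Fin n → Label
  lab v = proj₁ (labelled v)

  label-lab : ∀ {t v} → T (L v) ≤ t → label t v ≡ just (lab v)
  label-lab {v = v} le = label-mono le (proj₂ (labelled v))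

  lab-unique : ∀ {t v l} → label t v ≡ just l → l ≡ lab v
  lab-unique {t} {v} eq with ≤-total t (T (L v))
  ... | inj₁ le = just-injective (trans (sym (label-mono le eq)) (label-lab ≤-refl))
  ... | inj₂ ge = just-injective (trans (sym eq) (label-lab ge))

  lab-top : ∀ {v} → L v ≡ suc k → lab v ≡ E
  lab-top eq = sym (lab-unique (label-top eq))

  Origin : ℕ → Fin n → Label → Set
  Origin t v l = (l ≡ E × ∃[ s ] s < t × Exempt s v) ⊎ (T (L v) ≤ t × l ≡ localColour (T (L v)) v)

  origin : ∀ {t v l} → L v ≤ k → label t v ≡ just l → Origin t v l
  origin {zero} Lv≤k eq = contradiction (just⇒late eq) λ ()
  origin {suc t} {v} {l} Lv≤k eq = go (label t v) refl
    where
    go : ∀ m → label t v ≡ m → Origin (suc t) v l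
    go (just l′) eq′ with trans (sym (label-mono (n≤1+n t) eq′)) eq
    ... | refl with origin {t} Lv≤k eq′
    ...   | inj₁ (l≡E , s , s<t , ex) = inj₁ (l≡E , s , m<n⇒m<1+n s<t , ex)
    ...   | inj₂ (le , c)             = inj₂ (m≤n⇒m≤1+n le , c)
    go nothing eq′ with label-step Lv≤k (≤-pred (just⇒late eq)) eq′
    ... | inj₁ (ex , o) = inj₁ (just-injective (trans (sym eq) o) , t , ≤-refl , ex)
    ... | inj₂ (inj₁ (_ , time , o)) = inj₂ (≤-reflexive (sym time) ,
          trans (just-injective (trans (sym eq) o)) (cong (λ t → localColour t v) time))
    ... | inj₂ (inj₂ (_ , _ , o)) = contradiction (trans (sym eq) o) λ ()

  -- Before its deadline a node can only have answered E, so it does not matter whether an earlier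
  -- exemption came first.
  exempt⇒E : ∀ {t v} → L v ≤ k → t < T (L v) → Exempt t v → label (suc t) v ≡ just E
  exempt⇒E {t} {v} Lv≤k t<T ex@(_ , _ , _ , heard , _) = go (label t v) refl
    where
    go : ∀ m → label t v ≡ m → label (suc t) v ≡ just E
    go (just l) eq with origin {t} Lv≤k eq
    ... | inj₁ (refl , _) = label-mono (n≤1+n t) eq
    ... | inj₂ (le , _)   = contradiction t<T (≤⇒≯ le)
    go nothing eq with label-step Lv≤k (<⇒≤ (just⇒late heard)) eq
    ... | inj₁ (_ , o)              = o
    ... | inj₂ (inj₁ (¬ex , _ , _)) = contradiction ex ¬ex
    ... | inj₂ (inj₂ (¬ex , _ , _)) = contradiction ex ¬ex

  -- All lower levels have answered by `T j`, which lies strictly before the deadline of v, so the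
  -- answer of the lower neighbour is heard in time.
  lower-exempting : ∀ {v p} → L v ≤ k → L (nbr v p) < L v → lab (nbr v p) ≢ D → lab v ≡ E
  lower-exempting {v} {p} Lv≤k lower ≢D with L-suc v
  ... | j , eq = sym (lab-unique (exempt⇒E Lv≤k T<T
        (p , lower , lab (nbr v p) , label-lab (T-mono (≤-pred (subst (L (nbr v p) <_) eq lower))) , ≢D)))
    where
    T<T : T j < T (L v)
    T<T = subst (T j <_) (sym (T-pred eq)) (s≤s (m≤m+n _ _))

  -- At the deadline only `colour` speaks, and it never says E; so E stems from an exemption.
  E⇒lower : ∀ {v} → L v ≤ k → lab v ≡ E → ∃[ p ] L (nbr v p) < L v × lab (nbr v p) ≢ D
  E⇒lower {v} Lv≤k lab≡E with origin Lv≤k (label-lab {v = v} ≤-refl)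
  ... | inj₂ (_ , eq) = contradiction (trans (sym eq) lab≡E) (colour≢E (identity v) (far (state (T (L v)) v)) _)
  ... | inj₁ (_ , s , _ , p , lower , l , eq , ≢D) = p , lower , λ ≡D → ≢D (trans (lab-unique eq) ≡D)

  -- What a path knows at its deadline

  On : Fin n → Set
  On v = lab v ≢ E

  On? : ∀ v → Dec (On v)
  On? v = ¬? (E? (lab v))

  open Walks graph k On? public hiding (L)

  on-running : ∀ {t v} → L v ≤ k → On v → t < T (L v) → label t v ≡ nothing
  on-running {t} {v} Lv≤k on t<T = go (label t v) refl
    where
    go : ∀ m → label t v ≡ m → label t v ≡ nothing
    go nothing  eq = eq
    go (just l) eq with origin {t} Lv≤k eq
    ... | inj₁ (refl , _) = contradiction (sym (lab-unique eq)) on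
    ... | inj₂ (le , _)   = contradiction t<T (≤⇒≯ le)

  -- The lower neighbour responsible has answered by `T j`, so v ends by the following round. From
  -- then on the nodes of this level that still run are the non-exempt ones.
  off-done : ∀ {t v j} → L v ≤ k → L v ≡ suc j → ¬ On v → T j < t → label t v ≡ just E
  off-done {t} {v} {j} Lv≤k eq off T<t with E? (lab v)
  ... | no  on    = contradiction on off
  ... | yes lab≡E with E⇒lower Lv≤k lab≡E
  ...   | p , lower , ≢D = label-mono T<t (exempt⇒E Lv≤k
            (subst (T j <_) (sym (T-pred eq)) (s≤s (m≤m+n _ _)))
            (p , lower , _ , label-lab (T-mono (≤-pred (subst (L (nbr v p) <_) eq lower))) , ≢D))

  lab-colour : ∀ {v} → L v ≤ k → On v → lab v ≡ localColour (T (L v)) v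
  lab-colour {v} Lv≤k on with origin Lv≤k (label-lab {v = v} ≤-refl)
  ... | inj₁ (lab≡E , _) = contradiction lab≡E on
  ... | inj₂ (_ , eq)    = eq

  sideAt : ℕ → Dart → Info
  sideAt t (v , p) = side (identity v) (far (state t v)) p

  -- By `on-running` and `off-done`, in the window a neighbour of the same level is still sending
  -- iff it is non-exempt. So the ports with something to hear are the open ones.
  far-window : ∀ {t v j} → L v ≤ k → L v ≡ suc j → On v → T j < t → suc t ≤ T (L v) → ∀ p →
      (Open v p × far (state (suc t) v) p ≡ just (sideAt t (flip (v , p))))
    ⊎ (¬ Open v p × far (state (suc t) v) p ≡ nothing)
  far-window {t} {v} {j} Lv≤k eq on T<t t≤T p
    rewrite state-running {t} {v} (on-running Lv≤k on t≤T)
    with newLevels (state t v) (inbox t v) p ≟ lvl (state t v)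
  ... | no neq = inj₂ ((λ (eq′ , _) → neq (trans (newLevels≡ k≤t lt undone p) (trans eq′ (sym (LateAt.lvl≡ lt))))) , refl)
    where
    k≤t = <⇒≤ (<-trans (k<T j) T<t)
    lt = late k≤t v
    undone = on-running Lv≤k on t≤T
  ... | yes eq″ rewrite lookup∘tabulate (packet t v) p = go (On? (nbr v p))
    where
    k≤t = <⇒≤ (<-trans (k<T j) T<t)
    lt = late k≤t v
    undone = on-running Lv≤k on t≤T
    u = nbr v p
    Lu : L u ≡ L v
    Lu = trans (sym (newLevels≡ k≤t lt undone p)) (trans eq″ (LateAt.lvl≡ lt))
    go : Dec (On u) → _
    go (yes onu) = inj₁ ((Lu , onu) , trans
      (cong heardInfo (packet-running {t} {v} {p} (on-running (subst (_≤ k) (sym Lu) Lv≤k) onu (subst (t <_) (cong T (sym Lu)) t≤T))))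
      (cong (λ i → just (side i (far (state t u)) (rev v p))) (LateAt.ident≡ (late k≤t u))))
    go (no off)  = inj₂ ((λ op → off (proj₂ op)) ,
      cong heardInfo (packet-terminated {t} {v} {p} (off-done (subst (_≤ k) (sym Lu) Lv≤k) (trans Lu eq) off T<t)))

  -- What v heard before the window opened may be wrong, but its length
  -- is then at least the time spent in the window.
  sideAt-spec : ∀ {v j} t → L v ≤ k → L v ≡ suc j → On v → ∀ p → 2 + t + T j ≤ T (suc j) →
      (∃[ w ] Tail (v , p) (proj₁ (sideAt (2 + t + T j) (v , p))) w
              × proj₂ (sideAt (2 + t + T j) (v , p)) ≡ identity w)
    ⊎ (t < proj₁ (sideAt (2 + t + T j) (v , p)) × Long (v , p) (suc t))
  sideAt-spec {v} {j} t Lv≤k eq on p le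
    with side-spec (identity v) (far (state (2 + t + T j) v)) p
       | far-window {suc (t + T j)} Lv≤k eq on (s≤s (m≤n+m _ _)) (subst (2 + t + T j ≤_) (cong T (sym eq)) le)
  ... | inj₁ (eq′ , only) | fw = inj₁ (v , subst (λ i → Tail (v , p) (proj₁ i) v) (sym eq′) (stop none) , cong proj₂ eq′)
    where
    none : ∀ q → ¬ Continues (v , p) q
    none q (op , q≢p) with fw q
    ... | inj₁ (_ , heard) = q≢p (only q (_ , heard))
    ... | inj₂ (¬op , _)   = ¬op op
  ... | inj₂ (q , q≢p , i , heard , eq′) | fw with fw q
  ...   | inj₂ (_ , silent) = contradiction (trans (sym heard) silent) λ ()
  ...   | inj₁ (op , heard′) with just-injective (trans (sym heard) heard′)
  ...     | refl rewrite eq′ = further t le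
    where
    further : ∀ t → 2 + t + T j ≤ T (suc j) →
        (∃[ w ] Tail (v , p) (suc (proj₁ (sideAt (suc (t + T j)) (flip (v , q))))) w
                × proj₂ (sideAt (suc (t + T j)) (flip (v , q))) ≡ identity w)
      ⊎ (suc t ≤ suc (proj₁ (sideAt (suc (t + T j)) (flip (v , q)))) × Long (v , p) (suc t))
    further zero    _  = inj₂ (s≤s z≤n , (op , q≢p) ∷ [])
    further (suc t) le with sideAt-spec {nbr v q} {j} t (subst (_≤ k) (sym (proj₁ op)) Lv≤k)
                              (trans (proj₁ op) eq) (proj₂ op) (rev v q) (<⇒≤ le)
    ... | inj₁ (w , tl , id≡) = inj₁ (w , more (op , q≢p) tl , id≡)
    ... | inj₂ (lt , lg)      = inj₂ (s≤s lt , (op , q≢p) ∷ lg)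

  -- A path too long for the window need not show both of its ends, hence the two one-sided
  -- alternatives.
  Undecided : ℕ → Dart → Set
  Undecided θ d = Long d θ ⊎ Long (flip d) θ
    ⊎ (∃[ a ] ∃[ b ] ∃[ w ] ∃[ w′ ] Tail d a w × Tail (flip d) b w′ × θ ≤ a + b)

  -- The path has a + b + 2 nodes, so a + b is the same wherever on the path it is measured.
  Decided : ℕ → Dart → Set
  Decided θ d = ∃[ a ] ∃[ b ] ∃[ w ] ∃[ w′ ] Tail d a w × Tail (flip d) b w′ × a + b < θ
    × lab (head d) ≡ hue (a , identity w) (b , identity w′)

  -- By `sideAt-spec` a claim that is not exact exceeds θ and comes with a walk of more than θ
  -- steps. So a colour always rests on exact claims, and D on a path that really is long.
  verdict : ∀ {v j} → L v ≤ k → L v ≡ suc j → On v →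
      (lab v ≡ W × ∀ p → ¬ Open v p)
    ⊎ (∃[ p ] Open v p × (Decided (threshold n j) (v , p)
                          ⊎ (lab v ≡ D × Undecided (threshold n j) (v , p))))
  verdict {v} {j} Lv≤k eq on = result
    where
    θ = threshold n j
    -- Of the 3 extra rounds in `deadline`, one lets the exempt nodes answer and one lets their
    -- silence be noticed; the third carries the claim that the neighbour holds at time `t` over to
    -- v.
    t = 2 + θ + T j
    time : T (suc j) ≡ suc t
    time = +-comm (T j) (3 + θ)
    f = far (state (suc t) v)
    fw : _
    fw = far-window {t} Lv≤k eq on (s≤s (m≤n+m _ _)) (≤-reflexive (trans (sym time) (cong T (sym eq))))
    lab≡ : lab v ≡ colour (identity v) f θ
    lab≡ = trans (lab-colour Lv≤k on) (cong₂ (λ s i → colour (identity v) (far (state s v)) (threshold n (pred i)))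
             (trans (cong T eq) time) eq)
    result : _
    result with colour-spec (identity v) f θ
    ... | inj₁ (eq′ , none) = inj₁ (trans lab≡ eq′ , silent)
      where
      silent : ∀ p → ¬ Open v p
      silent p op with fw p
      ... | inj₁ (_ , heard) = none p (_ , heard)
      ... | inj₂ (¬op , _)   = ¬op op
    ... | inj₂ (p , i , heard , eq′) with fw p
    ...   | inj₂ (_ , silent) = contradiction (trans (sym heard) silent) λ ()
    ...   | inj₁ (op , heard′) with just-injective (trans (sym heard) heard′)
    ...     | refl = inj₂ (p , op , final)
      where
      s₁ = sideAt (suc t) (v , p)
      s₂ = sideAt t (flip (v , p))
      spec₁ : _
      spec₁ = sideAt-spec {v} {j} (1 + θ) Lv≤k eq on p (≤-reflexive (sym time))
      spec₂ : _
      spec₂ = sideAt-spec {nbr v p} {j} θ (subst (_≤ k) (sym (proj₁ op)) Lv≤k)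
                (trans (proj₁ op) eq) (proj₂ op) (rev v p) (≤-trans (n≤1+n _) (≤-reflexive (sym time)))
      final : _
      final with judge-spec (identity v) f θ s₁ s₂ | spec₁ | spec₂
      ... | inj₂ (θ≤ , eq″) | inj₁ (w , tl , _) | inj₁ (w′ , tl′ , _) =
            inj₂ (trans lab≡ (trans eq′ eq″) , inj₂ (inj₂ (_ , _ , w , w′ , tl , tl′ , θ≤)))
      ... | inj₂ (_ , eq″) | inj₂ (_ , lg) | _ =
            inj₂ (trans lab≡ (trans eq′ eq″) , inj₁ (long-≤ (m≤n+m θ 2) lg))
      ... | inj₂ (_ , eq″) | inj₁ _ | inj₂ (_ , lg) =
            inj₂ (trans lab≡ (trans eq′ eq″) , inj₂ (inj₁ (long-≤ (n≤1+n θ) lg)))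
      ... | inj₁ (<θ , eq″) | inj₁ (w , tl , id≡) | inj₁ (w′ , tl′ , id≡′) =
            inj₁ (_ , _ , w , w′ , tl , tl′ , <θ ,
              trans lab≡ (trans eq′ (trans eq″ (cong₂ (λ x y → hue (proj₁ s₁ , x) (proj₁ s₂ , y)) id≡ id≡′))))
      ... | inj₁ (<θ , _) | inj₂ (lt , _) | _ =
            contradiction (≤-trans (≤-trans (n≤1+n _) (<⇒≤ lt)) (m≤m+n _ _)) (<⇒≱ <θ)
      ... | inj₁ (<θ , _) | inj₁ _ | inj₂ (lt , _) =
            contradiction (≤-trans (<⇒≤ lt) (m≤n+m _ _)) (<⇒≱ <θ)

-- One node judged through its two ports: either way it is at distance `suc a` from x and `suc b`
-- from y.
hue-swap : ∀ {a b x y} → x ≢ y → hue (suc a , x) (b , y) ≡ hue (suc b , y) (a , x)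
hue-swap {x = x} {y} x≢y with x <? y | y <? x
... | yes x<y | yes y<x = contradiction y<x (<-asym x<y)
... | yes _   | no _    = refl
... | no _    | yes _   = refl
... | no x≮y  | no y≮x  = contradiction (≤-antisym (≮⇒≥ y≮x) (≮⇒≥ x≮y)) x≢y

-- The two nodes of one edge: both measure to the same end, and their distances to it differ by one.
hue-≢ : ∀ {a b x y} → x ≢ y → hue (a , x) (b , y) ≢ hue (b , y) (a , x)
hue-≢ {a} {b} {x} {y} x≢y with x <? y | y <? x
... | yes x<y | yes y<x = contradiction y<x (<-asym x<y)
... | yes _   | no _    = parity-suc a
... | no _    | yes _   = parity-suc b ∘ sym
... | no x≮y  | no y≮x  = contradiction (≤-antisym (≮⇒≥ y≮x) (≮⇒≥ x≮y)) x≢y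

WB≢D : ∀ {l} → l ≡ W ⊎ l ≡ B → l ≢ D
WB≢D (inj₁ refl) ()
WB≢D (inj₂ refl) ()

≢D⇒WBE : ∀ {l} → l ≢ D → l ≡ W ⊎ l ≡ B ⊎ l ≡ E
≢D⇒WBE {W} _  = inj₁ refl
≢D⇒WBE {B} _  = inj₂ (inj₁ refl)
≢D⇒WBE {E} _  = inj₂ (inj₂ refl)
≢D⇒WBE {D} ≢D = contradiction refl ≢D

WBE⇒≢D : ∀ {l} → l ≡ W ⊎ l ≡ B ⊎ l ≡ E → l ≢ D
WBE⇒≢D (inj₁ refl)        ()
WBE⇒≢D (inj₂ (inj₁ refl)) ()
WBE⇒≢D (inj₂ (inj₂ refl)) ()

-- Conditional sums and lists without repetition

when : ∀ {p} {P : Set p} → Dec P → ℕ → ℕ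
when (yes _) m = m
when (no _)  _ = 0

when-yes : ∀ {p} {P : Set p} (P? : Dec P) {m} → P → when P? m ≡ m
when-yes (yes _) _ = refl
when-yes (no ¬p) p = contradiction p ¬p

sum-when : ∀ {a p} {A : Set a} {P : A → Set p} (P? : Decidable P) (w : A → ℕ) xs →
           sum (map (λ x → when (P? x) (w x)) xs) ≡ sum (map w (filter P? xs))
sum-when P? w []       = refl
sum-when P? w (x ∷ xs) with P? x
... | yes _ = cong (w x +_) (sum-when P? w xs)
... | no  _ = sum-when P? w xs

unique-map : ∀ {a b} {A : Set a} {B : Set b} (f : A → B) {xs} →
             (∀ {x y} → x ∈ˡ xs → y ∈ˡ xs → f x ≡ f y → x ≡ y) → Unique xs → Unique (map f xs)
unique-map f inj []          = []
unique-map f inj (x∉xs ∷ u) =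
  All.map⁺ (All.tabulate λ y∈ eq → All.lookup x∉xs y∈ (inj (here refl) (there y∈) eq))
  ∷ unique-map f (λ x∈ y∈ → inj (there x∈) (there y∈)) u

length-cartesianProduct : ∀ {a b} {A : Set a} {B : Set b} (xs : List A) (ys : List B) →
                          length (cartesianProduct xs ys) ≡ length xs * length ys
length-cartesianProduct []       ys = refl
length-cartesianProduct (x ∷ xs) ys = trans (length-++ (map (x ,_) ys))
  (cong₂ _+_ (length-map (x ,_) ys) (length-cartesianProduct xs ys))

-- Correctness of the labelling

module Counting (k : ℕ) (threshold : ℕ → ℕ → ℕ) {Δ c n : ℕ} (I : Instance Δ c n) where
  open Instance I hiding (ident)
  open Instance I using () renaming (ident to identity)
  open Outcome k threshold I
  open Levels graph using (level≥1; length-ups; ups; lower-neighbour)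

  L : Fin n → ℕ
  L = level graph k

  allDarts : List Dart
  allDarts = concatMap (λ v → map (v ,_) (allFin (deg v))) (allFin n)

  ∈-allDarts : ∀ d → d ∈ˡ allDarts
  ∈-allDarts (v , p) = ∈-concatMap⁺ (λ v → map (v ,_) (allFin (deg v))) {xs = allFin n}
    (lose (∈-allFin v) (∈-map⁺ (v ,_) (∈-allFin p)))

  unique-allDarts : Unique allDarts
  unique-allDarts = Unique.concat⁺
    (All.map⁺ (All.universal (λ v → Unique.map⁺ (λ { refl → refl }) (Unique.allFin⁺ (deg v))) _))
    (AllPairs.map⁺ (AllPairs.map disjoint (Unique.allFin⁺ n)))
    where
    disjoint : ∀ {u v} → u ≢ v → Disjoint (map (u ,_) (allFin (deg u))) (map (v ,_) (allFin (deg v)))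
    disjoint u≢v (d∈ , d∈′) with ∈-map⁻ _ d∈ | ∈-map⁻ _ d∈′
    ... | _ , _ , refl | _ , _ , refl = u≢v refl

  good? : Decidable Good
  good? d = (L (head d) ≤? k) ×-dec (L (head d) ≤? L (tail d))

  goodPorts : ∀ v → List (Fin (deg v))
  goodPorts v = filter (λ p → good? (v , p)) (allFin (deg v))

  length-goodPorts : ∀ v → length (goodPorts v) ≤ 2
  length-goodPorts v = by-level (L v ≤? k)
    where
    unique : Unique (goodPorts v)
    unique = Unique.filter⁺ (λ p → good? (v , p)) (Unique.allFin⁺ _)
    ∈⁻ : ∀ {p} → p ∈ˡ goodPorts v → Good (v , p)
    ∈⁻ p∈ = proj₂ (∈-filter⁻ (λ p → good? (v , p)) {xs = allFin _} p∈)
    by-level : Dec (L v ≤ k) → length (goodPorts v) ≤ 2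
    by-level (yes Lv≤k) = ≤-trans
      (length-⊆ {ys = ups k v} unique λ p∈ → ∈-filter⁺ _ (∈-allFin _) (proj₂ (∈⁻ p∈)))
      (length-ups k v Lv≤k)
    by-level (no Lv≰k) = ≤-trans
      (length-⊆ {ys = []} unique λ p∈ → contradiction (proj₁ (∈⁻ p∈)) Lv≰k)
      z≤n

  goodDarts : List Dart
  goodDarts = concatMap (λ v → map (v ,_) (goodPorts v)) (allFin n)

  -- A good dart uses an upward port of its head, so a node is the head of at most two of them. This
  -- yields both the factor 2 in `entries-*≤` and the bounded charge of exempt nodes in `sum-below`.
  charge : ∀ {a} {A : Set a} (g : Fin n → ℕ) (f : A → Dart) (xs : List A) → Unique (map f xs) →
           (∀ {x} → x ∈ˡ xs → Good (f x)) →
           sum (map (g ∘ head ∘ f) xs) ≤ 2 * sum (map g (allFin n))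
  charge g f xs uniq good = begin
    sum (map (g ∘ head ∘ f) xs)                    ≡⟨ cong sum (map-∘ xs) ⟩
    sum (map (g ∘ head) (map f xs))                ≤⟨ sum-⊆ (g ∘ head) uniq sub ⟩
    sum (map (g ∘ head) goodDarts)                 ≡⟨ sum-concatMap (g ∘ head) (λ v → map (v ,_) (goodPorts v)) (allFin n) ⟩
    sum (map (λ v → sum (map (g ∘ head) (map (v ,_) (goodPorts v)))) (allFin n))
                                                   ≤⟨ sum-map-mono _ (allFin n) (λ {v} _ → node v) ⟩
    sum (map (λ v → 2 * g v) (allFin n))           ≡⟨ sum-map-*ˡ 2 g (allFin n) ⟩
    2 * sum (map g (allFin n))                     ∎
    where
    open ≤-Reasoning
    sub : map f xs ⊆ˡ goodDarts
    sub d∈ with ∈-map⁻ f d∈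
    ... | x , x∈ , refl = ∈-concatMap⁺ (λ v → map (v ,_) (goodPorts v)) {xs = allFin n}
          (lose (∈-allFin (head (f x))) (∈-map⁺ _ (∈-filter⁺ (λ p → good? (head (f x) , p)) (∈-allFin _) (good x∈))))
    node : ∀ v → sum (map (g ∘ head) (map (v ,_) (goodPorts v))) ≤ 2 * g v
    node v = ≤-trans (≤-reflexive (trans (cong sum (sym (map-∘ (goodPorts v)))) (sum-map-const (g v) (goodPorts v))))
                     (*-monoˡ-≤ (g v) (length-goodPorts v))

  on-level? : ∀ j → Decidable (λ v → L v ≡ suc j × On v)
  on-level? j v = (L v ≟ suc j) ×-dec On? v

  active : ℕ → List (Fin n)
  active j = filter (on-level? j) (allFin n)

  ∈-active⁺ : ∀ {j v} → L v ≡ suc j → On v → v ∈ˡ active j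
  ∈-active⁺ {j} eq on = ∈-filter⁺ (on-level? j) (∈-allFin _) (eq , on)

  ∈-active⁻ : ∀ {j v} → v ∈ˡ active j → L v ≡ suc j × On v
  ∈-active⁻ {j} v∈ = proj₂ (∈-filter⁻ (on-level? j) {xs = allFin n} v∈)

  unique-active : ∀ j → Unique (active j)
  unique-active j = Unique.filter⁺ (on-level? j) (Unique.allFin⁺ n)

  decided⇒≢D : ∀ {θ d} → Decided θ d → lab (head d) ≢ D
  decided⇒≢D (a , b , w , w′ , _ , _ , _ , eq) ≡D =
    WB≢D (hue-WB (a , identity w) (b , identity w′)) (trans (sym eq) ≡D)

  D⇒on : ∀ {v} → lab v ≡ D → On v
  D⇒on eq eq′ = contradiction (trans (sym eq) eq′) λ ()

  D⇒undecided : ∀ {v j} → L v ≤ k → L v ≡ suc j → lab v ≡ D →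
                ∃[ p ] Open v p × Undecided (threshold n j) (v , p)
  D⇒undecided Lv≤k eq ≡D with verdict Lv≤k eq (D⇒on ≡D)
  ... | inj₁ (≡W , _)                   = contradiction (trans (sym ≡W) ≡D) λ ()
  ... | inj₂ (_ , _ , inj₁ dec)         = contradiction ≡D (decided⇒≢D dec)
  ... | inj₂ (p , op , inj₂ (_ , und)) = p , op , und

  -- If both ends are known, neither direction alone need reach θ steps; `shift` then starts the
  -- walk at one end, where all a + b steps lie ahead.
  D⇒long : ∀ {v j} → L v ≤ k → L v ≡ suc j → lab v ≡ D →
           ∃[ d ] Good d × On (head d) × L (head d) ≡ suc j × Long d (threshold n j)
  D⇒long {v} Lv≤k eq ≡D with D⇒undecided Lv≤k eq ≡D
  ... | p , op , inj₁ lg = (v , p) , open⇒good Lv≤k op , D⇒on ≡D , eq , lg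
  ... | p , op , inj₂ (inj₁ lg) = flip (v , p) , good-flip Lv≤k op , proj₂ op , trans (proj₁ op) eq , lg
  ... | p , op , inj₂ (inj₂ (_ , _ , _ , _ , t , t′ , θ≤)) with shift acyclic Lv≤k (D⇒on ≡D) op t t′
  ...   | d , _ , g , on , Ld , t″ = d , g , on , trans Ld eq , long-≤ θ≤ (tail⇒long t″)

  long⇒active : ∀ {d j m} → Good d → On (head d) → L (head d) ≡ suc j → Long d m → suc m ≤ length (active j)
  long⇒active {d} {j} {m} g on Ld lg =
    subst (_≤ length (active j)) (length-applyUpTo (λ i → head (walk i d)) (suc m))
      (length-⊆ (Unique.applyUpTo⁺₁ _ (suc m) λ i<i′ i′< → visited-≢ acyclic g lg (s≤s i<i′) i′<) sub)
    where
    sub : applyUpTo (λ i → head (walk i d)) (suc m) ⊆ˡ active j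
    sub v∈ with ∈-applyUpTo⁻ (λ i → head (walk i d)) v∈
    ... | i , s≤s i≤ , refl = ∈-active⁺ (trans (walk-L {j = i} g lg i≤) Ld) (walk-On {j = i} on g lg i≤)

  ≢D-at-k : ∀ {v j} → L v ≤ k → L v ≡ suc j → length (active j) ≤ threshold n j → lab v ≢ D
  ≢D-at-k Lv≤k eq few ≡D with D⇒long Lv≤k eq ≡D
  ... | d , g , on , Ld , lg = contradiction (long⇒active g on Ld lg) (≤⇒≯ few)

  -- Looking through the other port moves v itself from one side of the cut to the other: one tail
  -- loses a step and the other gains it.
  rotate : ∀ {v p q a b w w′} → L v ≤ k → Open v p → Open v q → p ≢ q →
           Tail (v , p) a w → Tail (flip (v , p)) b w′ →
           ∃[ a′ ] a ≡ suc a′ × Tail (flip (v , q)) a′ w × Tail (v , q) (suc b) w′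
  rotate {v} {p} {q} Lv≤k op oq p≢q (stop none) t′ = contradiction (oq , p≢q ∘ sym) (none q)
  rotate {v} {p} {q} Lv≤k op oq p≢q (more c t) t′
    with continues-unique (open⇒good Lv≤k op) c (oq , p≢q ∘ sym)
  ... | refl = _ , refl , t , more (op , p≢q) t′

  -- Neighbours can be compared only over their common edge, but each may have judged through its
  -- other port. `rotate` transfers the tails to the wanted port, and `hue-swap` keeps the colour.
  verdict-at : ∀ {v j p} → L v ≤ k → L v ≡ suc j → On v → Open v p →
      Decided (threshold n j) (v , p)
    ⊎ (lab v ≡ D × (∀ {a b w w′} → Tail (v , p) a w → Tail (flip (v , p)) b w′ → threshold n j ≤ a + b))
  verdict-at {v} {j} {p} Lv≤k eq on op with verdict Lv≤k eq on
  ... | inj₁ (_ , none) = contradiction op (none p)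
  ... | inj₂ (q , oq , res) with p Fin.≟ q
  ...   | yes refl = Sum.map₂ (λ (≡D , und) → ≡D , both und) res
    where
    both : Undecided (threshold n j) (v , p) → ∀ {a b w w′} → Tail (v , p) a w → Tail (flip (v , p)) b w′ → threshold n j ≤ a + b
    both (inj₁ lg)        t t′ = ≤-trans (tail-long-≤ (open⇒good Lv≤k op) t lg) (m≤m+n _ _)
    both (inj₂ (inj₁ lg)) t t′ = ≤-trans (tail-long-≤ (good-flip Lv≤k op) t′ lg) (m≤n+m _ _)
    both (inj₂ (inj₂ (_ , _ , _ , _ , t₁ , t₁′ , θ≤))) t t′
      with tail-unique (open⇒good Lv≤k op) t t₁ | tail-unique (good-flip Lv≤k op) t′ t₁′
    ... | refl , _ | refl , _ = θ≤
  ...   | no p≢q with res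
  ...     | inj₁ (_ , b , w , w′ , t , t′ , <θ , lab≡) with rotate Lv≤k oq op (p≢q ∘ sym) t t′
  ...       | a′ , refl , t₁ , t₁′ = inj₁ (suc b , a′ , w′ , w , t₁′ , t₁ ,
              subst (_< threshold n j) (cong suc (+-comm a′ b)) <θ ,
              trans lab≡ (hue-swap (ends-≢ acyclic Lv≤k on oq t t′ ∘ ident-inj)))
  verdict-at {v} {j} {p} Lv≤k eq on op | inj₂ (q , oq , res) | no p≢q | inj₂ (≡D , und) =
    inj₂ (≡D , λ t t′ → both und t t′)
    where
    both : Undecided (threshold n j) (v , q) → ∀ {a b w w′} → Tail (v , p) a w → Tail (flip (v , p)) b w′ → threshold n j ≤ a + b
    both und t t′ with rotate Lv≤k op oq p≢q t t′
    both (inj₁ lg) t t′ | a′ , refl , t₁ , t₁′ =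
      ≤-trans (tail-long-≤ (open⇒good Lv≤k oq) t₁′ lg) (s≤s (m≤n+m _ _))
    both (inj₂ (inj₁ lg)) t t′ | a′ , refl , t₁ , t₁′ =
      ≤-trans (tail-long-≤ (good-flip Lv≤k oq) t₁ lg) (≤-trans (n≤1+n _) (m≤m+n _ _))
    both (inj₂ (inj₂ (_ , _ , _ , _ , t₂ , t₂′ , θ≤))) {b = b} t t′ | a′ , refl , t₁ , t₁′
      with tail-unique (open⇒good Lv≤k oq) t₁′ t₂ | tail-unique (good-flip Lv≤k oq) t₁ t₂′
    ... | refl , _ | refl , _ = ≤-trans θ≤ (≤-reflexive (cong suc (+-comm b a′)))

  -- Over the common edge both nodes judge by the same two tails in opposite order. The totals
  -- agree, so they are coloured together or answer D together, and `hue-≢` separates the colours.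
  proper : ∀ {v p} → L v ≤ k → On v → lab v ≢ D → Open v p → lab (nbr v p) ≢ D × lab (nbr v p) ≢ lab v
  proper {v} {p} Lv≤k on ≢D op with L-suc v
  ... | j , eq with verdict-at Lv≤k eq on op
  ...   | inj₂ (≡D , _) = contradiction ≡D ≢D
  ...   | inj₁ (a , b , w , w′ , t , t′ , <θ , lab≡)
        with verdict-at {nbr v p} {j} {rev v p} (subst (_≤ k) (sym (proj₁ op)) Lv≤k) (trans (proj₁ op) eq) (proj₂ op) (open-flip on op)
  ...     | inj₂ (_ , θ≤) = contradiction (θ≤ t′ (subst (λ d → Tail d a w) (sym (flip-flip (v , p))) t))
                                          (<⇒≱ (subst (_< threshold n j) (+-comm a b) <θ))
  ...     | inj₁ dec@(b₁ , a₁ , w₁′ , w₁ , t₁′ , t₁ , _ , lab≡′)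
          with tail-unique (good-flip Lv≤k op) t′ t₁′
             | tail-unique (open⇒good Lv≤k op) t (subst (λ d → Tail d a₁ w₁) (flip-flip (v , p)) t₁)
  ...       | refl , refl | refl , refl =
    decided⇒≢D dec , λ same → hue-≢ (ends-≢ acyclic Lv≤k on op t t′ ∘ ident-inj)
      (trans (sym lab≡) (trans (sym same) lab≡′))

  colouring : 1 ≤ k → (∀ {j} → suc j ≡ k → length (active j) ≤ threshold n j) →
              IsHierarchicalColoring k graph lab
  colouring 1≤k few = record
    { level-1   = λ v eq ≡E → case E⇒lower (subst (_≤ k) (sym eq) 1≤k) ≡E of λ
        (p , lower , _) → <⇒≱ (subst (L (nbr v p) <_) eq lower) (level≥1 k _)
    ; level-k+1 = λ v → lab-top
    ; exempt    = λ v _ Lv≤k → mk⇔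
        (λ ≡E → case E⇒lower Lv≤k ≡E of λ (p , lower , ≢D) → nbr v p , (p , refl) , lower , ≢D⇒WBE ≢D)
        (λ { (_ , (p , refl) , lower , wbe) → lower-exempting Lv≤k lower (WBE⇒≢D wbe) })
    ; white     = λ v _ Lv≤k eq → monochromatic Lv≤k (inj₁ eq) eq
    ; black     = λ v _ Lv≤k eq → monochromatic Lv≤k (inj₂ eq) eq
    ; level-k   = λ v eq → case L-suc v of λ (j , eq′) →
        ≢D-at-k (≤-reflexive eq) eq′ (few (trans (sym eq′) eq))
    }
    where
    WB≢E : ∀ {l} → l ≡ W ⊎ l ≡ B → l ≢ E
    WB≢E (inj₁ refl) ()
    WB≢E (inj₂ refl) ()
    monochromatic : ∀ {v l} → L v ≤ k → lab v ≡ W ⊎ lab v ≡ B → lab v ≡ l →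
                    ∀ u → Adj v u → L u ≡ L v → lab u ≢ l × lab u ≢ D
    monochromatic {v} {l} Lv≤k wb eq u (p , refl) Lu with E? (lab u)
    ... | yes ≡E = (λ ≡l → WB≢E wb (trans eq (trans (sym ≡l) ≡E))) , λ ≡D → contradiction (trans (sym ≡E) ≡D) λ ()
    ... | no  on = (λ ≡l → proj₂ pr (trans ≡l (sym eq))) , proj₁ pr
      where pr = proper Lv≤k (WB≢E wb) (WB≢D wb) (Lu , on)

  -- Decay of the non-exempt nodes from level to level

  entry? : ∀ j → Decidable (λ d → L (head d) ≡ suc j × lab (head d) ≡ D × L (tail d) ≡ suc (suc j))
  entry? j d = (L (head d) ≟ suc j) ×-dec (D? (lab (head d)) ×-dec (L (tail d) ≟ suc (suc j)))

  entries : ℕ → List Dart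
  entries j = filter (entry? j) allDarts

  module _ {j : ℕ} (ssj≤k : suc (suc j) ≤ k) (1≤θ : 1 ≤ threshold n j) where
    private
      θ = threshold n j
      sj≤k : suc j ≤ k
      sj≤k = <⇒≤ ssj≤k

      entry : ∀ {d} → d ∈ˡ entries j → L (head d) ≡ suc j × lab (head d) ≡ D × L (tail d) ≡ suc (suc j)
      entry d∈ = proj₂ (∈-filter⁻ (entry? j) {xs = allDarts} d∈)

    -- Each active node of level j + 2 has a neighbour of level exactly j + 1 by `lower-neighbour`,
    -- and that neighbour says D, as otherwise it would exempt the node.
    active-suc≤entries : length (active (suc j)) ≤ length (entries j)
    active-suc≤entries = subst (length (active (suc j)) ≤_) (length-map tail (entries j))
      (length-⊆ (unique-active (suc j)) sub)
      where
      sub : active (suc j) ⊆ˡ map tail (entries j)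
      sub {v} v∈ with ∈-active⁻ v∈
      ... | eq , on with lower-neighbour k eq (subst (_≤ k) (sym eq) ssj≤k)
      ...   | p , Lu = subst (_∈ˡ map tail (entries j)) (tail-flip (v , p))
              (∈-map⁺ tail (∈-filter⁺ (entry? j) (∈-allDarts (flip (v , p)))
                (Lu , u≡D , trans (cong L (tail-flip (v , p))) eq)))
        where
        u≡D : lab (nbr v p) ≡ D
        u≡D with D? (lab (nbr v p))
        ... | yes ≡D = ≡D
        ... | no  ≢D = contradiction (lower-exempting (subst (_≤ k) (sym eq) ssj≤k)
                          (≤-reflexive (trans (cong suc Lu) (sym eq))) ≢D) on

    entry-good : ∀ {d} → d ∈ˡ entries j → Good d
    entry-good d∈ with entry d∈
    ... | eq , _ , eq′ = subst (_≤ k) (sym eq) sj≤k , subst₂ _≤_ (sym eq) (sym eq′) (n≤1+n _)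

    -- The entry takes one of the two upward ports of its head, which is therefore an end of its
    -- D-path. Nothing lies on the outer side, so being undecided means θ further steps inwards.
    entry-long : ∀ {d} → d ∈ˡ entries j → Long d θ
    entry-long {v , q} d∈ with entry d∈
    ... | eq , ≡D , eq′ with D⇒undecided (subst (_≤ k) (sym eq) sj≤k) eq ≡D
    ...   | p , op , und = long-≤ (n≤1+n θ) ((op , p≢q) ∷ inward und)
      where
      p≢q : p ≢ q
      p≢q refl = contradiction (trans (sym eq′) (trans (proj₁ op) eq)) λ ()
      good-q : Good (v , q)
      good-q = entry-good d∈
      blocked : ∀ r → ¬ Continues (v , p) r
      blocked r (or , r≢p) = r≢q (ups-≤2 (proj₁ good-q) (≤-reflexive (sym (proj₁ op))) (≤-reflexive (sym (proj₁ or))) (proj₂ good-q) (r≢p ∘ sym) p≢q)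
        where
        r≢q : r ≢ q
        r≢q refl = contradiction (trans (sym eq′) (trans (proj₁ or) eq)) λ ()
      inward : Undecided θ (v , p) → Long (flip (v , p)) θ
      inward (inj₁ lg) with long-≤ 1≤θ lg
      ... | c ∷ _ = contradiction c (blocked _)
      inward (inj₂ (inj₁ lg)) = lg
      inward (inj₂ (inj₂ (_ , _ , _ , _ , stop _ , t′ , θ≤))) = long-≤ θ≤ (tail⇒long t′)
      inward (inj₂ (inj₂ (_ , _ , _ , _ , more c _ , _ , _))) = contradiction c (blocked _)

    -- Equal darts are traced back by `next-injective` until one walk is at its entry. There the
    -- other must be as well: the tail of an entry has level j + 2, the tail of any later dart level
    -- j + 1.
    walk-injective : ∀ i i′ {d d′} → d ∈ˡ entries j → d′ ∈ˡ entries j → i < θ → i′ < θ →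
                     walk i d ≡ walk i′ d′ → i ≡ i′ × d ≡ d′
    walk-injective zero zero _ _ _ _ eq = refl , eq
    walk-injective zero (suc i′) d∈ d′∈ _ lt eq = contradiction eq (entry≢walk i′ d∈ d′∈ lt)
      where
      entry≢walk : ∀ i {d d′} → d ∈ˡ entries j → d′ ∈ˡ entries j → suc i < θ → d ≢ walk (suc i) d′
      entry≢walk i {d} {d′} d∈ d′∈ lt eq = contradiction
        (trans (sym (proj₂ (proj₂ (entry d∈))))
          (trans (cong L (trans (cong tail (trans eq (walk-suc i d′)))
                   (tail-next (walk-good {j = i} (entry-good d′∈) (entry-long d′∈) (<⇒≤ (<⇒≤ lt)))
                     (proj₂ (walk-continues {j = i} (entry-good d′∈) (entry-long d′∈) (<⇒≤ lt))))))
                 (trans (walk-L {j = i} (entry-good d′∈) (entry-long d′∈) (<⇒≤ (<⇒≤ lt))) (proj₁ (entry d′∈)))))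
        λ ()
    walk-injective (suc i) zero d∈ d′∈ lt lt′ eq with walk-injective zero (suc i) d′∈ d∈ lt′ lt (sym eq)
    ... | () , _
    walk-injective (suc i) (suc i′) {d} {d′} d∈ d′∈ lt lt′ eq
      with walk-injective i i′ d∈ d′∈ (<⇒≤ lt) (<⇒≤ lt′)
        (next-injective (walk-good {j = i} (entry-good d∈) (entry-long d∈) (<⇒≤ (<⇒≤ lt)))
          (walk-good {j = i′} (entry-good d′∈) (entry-long d′∈) (<⇒≤ (<⇒≤ lt′)))
          (proj₂ (walk-continues {j = i} (entry-good d∈) (entry-long d∈) (<⇒≤ lt)))
          (proj₂ (walk-continues {j = i′} (entry-good d′∈) (entry-long d′∈) (<⇒≤ lt′)))
          (trans (sym (walk-suc i d)) (trans eq (walk-suc i′ d′))))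
    ... | refl , d≡d′ = refl , d≡d′

    -- The first θ darts of the walks from all entries are distinct and good, with heads in
    -- `active j`. A D-path may be entered at both ends and is then traversed in both directions.
    entries-*≤ : length (entries j) * θ ≤ 2 * length (active j)
    entries-*≤ = begin
      length (entries j) * θ                              ≡⟨ cong (length (entries j) *_) (sym (length-applyUpTo id θ)) ⟩
      length (entries j) * length (upTo θ)                ≡⟨ length-cartesianProduct (entries j) (upTo θ) ⟨
      length steps                                        ≡⟨ trans (sum-map-const 1 steps) (*-identityʳ _) ⟨
      sum (map (λ _ → 1) steps)                           ≤⟨ sum-map-mono _ steps weight ⟩
      sum (map (g ∘ head ∘ f) steps)                      ≤⟨ charge g f steps uniq good ⟩
      2 * sum (map g (allFin n))                          ≡⟨ cong (2 *_) (sum-when (on-level? j) (λ _ → 1) (allFin n)) ⟩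
      2 * sum (map (λ _ → 1) (active j))                  ≡⟨ cong (2 *_) (trans (sum-map-const 1 (active j)) (*-identityʳ (length (active j)))) ⟩
      2 * length (active j)                               ∎
      where
      open ≤-Reasoning
      steps = cartesianProduct (entries j) (upTo θ)
      f : Dart × ℕ → Dart
      f (d , i) = walk i d
      g : Fin n → ℕ
      g v = when (on-level? j v) 1
      ∈⁻ : ∀ {x} → x ∈ˡ steps → proj₁ x ∈ˡ entries j × proj₂ x < θ
      ∈⁻ x∈ with ∈-cartesianProduct⁻ (entries j) (upTo θ) x∈
      ... | d∈ , i∈ = d∈ , ∈-upTo⁻ i∈
      good : ∀ {x} → x ∈ˡ steps → Good (f x)
      good {d , i} x∈ with ∈⁻ x∈
      ... | d∈ , i<θ = walk-good {j = i} (entry-good d∈) (entry-long d∈) (<⇒≤ i<θ)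
      weight : ∀ {x} → x ∈ˡ steps → 1 ≤ g (head (f x))
      weight {d , i} x∈ with ∈⁻ x∈
      ... | d∈ , i<θ = ≤-reflexive (sym (when-yes (on-level? j (head (walk i d)))
            ( trans (walk-L {j = i} (entry-good d∈) (entry-long d∈) (<⇒≤ i<θ)) (proj₁ (entry d∈))
            , walk-On {j = i} (D⇒on (proj₁ (proj₂ (entry d∈)))) (entry-good d∈) (entry-long d∈) (<⇒≤ i<θ))))
      uniq : Unique (map f steps)
      uniq = unique-map f inj
        (Unique.cartesianProduct⁺ (Unique.filter⁺ (entry? j) unique-allDarts) (Unique.upTo⁺ θ))
        where
        inj : ∀ {x y} → x ∈ˡ steps → y ∈ˡ steps → f x ≡ f y → x ≡ y
        inj {d , i} {d′ , i′} x∈ y∈ eq with ∈⁻ x∈ | ∈⁻ y∈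
        ... | d∈ , i< | d′∈ , i′< with walk-injective i i′ d∈ d′∈ i< i′< eq
        ...   | refl , refl = refl

    active-suc : length (active (suc j)) * θ ≤ 2 * length (active j)
    active-suc = ≤-trans (*-monoˡ-≤ θ active-suc≤entries) entries-*≤

-- The sum of the termination times

when-≤ : ∀ {p} {P : Set p} (P? : Dec P) {m x} → (P → m ≤ x) → when P? m ≤ x
when-≤ (yes p) le = le p
when-≤ (no _)  _  = z≤n

≤-when : ∀ {p} {P : Set p} (P? : Dec P) {m} → P → m ≤ when P? m
≤-when P? p = ≤-reflexive (sym (when-yes P? p))

sum-allFin : ∀ {n} (w : Fin n → ℕ) → foldr _+_ 0 w ≡ sum (map w (allFin n))
sum-allFin w = trans (go w) (cong sum (sym (map-tabulate id w)))
  where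
  go : ∀ {n} (w : Fin n → ℕ) → foldr _+_ 0 w ≡ sum (List.tabulate w)
  go {zero}  w = refl
  go {suc n} w = cong (w zero +_) (go (w ∘ suc))

module Rounds (k : ℕ) (threshold : ℕ → ℕ → ℕ) {Δ c n : ℕ} (I : Instance Δ c n) where
  open Instance I hiding (ident)
  open Protocol k threshold using (algorithm; module Run)
  open Run I using (label; state; stateAfter≡state)
  open Outcome k threshold I
  open Counting k threshold I
  open Levels graph using (level≤)

  first-label : ∀ t {v l} → label t v ≡ just l →
                ∃[ s ] label s v ≡ just l × (∀ s′ → s′ < s → label s′ v ≡ nothing)
  first-label zero    eq = zero , eq , λ _ ()
  first-label (suc t) {v} {l} eq = go (label t v) refl
    where
    go : ∀ m → label t v ≡ m → ∃[ s ] label s v ≡ just l × (∀ s′ → s′ < s → label s′ v ≡ nothing)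
    go (just l′) eq′ with trans (sym (label-mono (n≤1+n t) eq′)) eq
    ... | refl = first-label t eq′
    go nothing eq′ = suc t , eq , λ { s′ (s≤s s′≤t) → before s′≤t (label s′ v) refl }
      where
      before : ∀ {s′} → s′ ≤ t → ∀ m → label s′ v ≡ m → label s′ v ≡ nothing
      before _  nothing  eq″ = eq″
      before le (just _) eq″ = contradiction (trans (sym (label-mono le eq″)) eq′) λ ()

  execution : Execution algorithm I
  execution = record
    { rounds     = λ v → proj₁ (first v)
    ; result     = lab
    ; terminates = λ v → record
      { outputs = trans (cong out (stateAfter≡state _ v)) (proj₁ (proj₂ (first v)))
      ; first   = λ s s< → trans (cong out (stateAfter≡state s v)) (proj₂ (proj₂ (first v)) s s<)
      }
    }
    where
    first : ∀ v → ∃[ s ] label s v ≡ just (lab v) × (∀ s′ → s′ < s → label s′ v ≡ nothing)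
    first v = first-label _ (label-lab {v = v} ≤-refl)

  module _ (e : Execution algorithm I) where
    open Execution e

    rounds≤ : ∀ {t v l} → label t v ≡ just l → rounds v ≤ t
    rounds≤ {t} {v} eq with rounds v ≤? t
    ... | yes le = le
    ... | no ≰ = contradiction
      (trans (sym eq) (trans (sym (cong out (stateAfter≡state t v))) (TerminatesAfter.first (terminates v) t (≰⇒> ≰))))
      λ ()

    label-rounds : ∀ v → label (rounds v) v ≡ just (lab v)
    label-rounds v = trans eq (cong just (lab-unique eq))
      where
      eq : label (rounds v) v ≡ just (result v)
      eq = trans (sym (cong out (stateAfter≡state _ v))) (TerminatesAfter.outputs (terminates v))

    -- The lower neighbour ends before the deadline of v, so `exempt⇒E` applies at the very round in
    -- which it ends.
    rounds-exempt : ∀ {v p} → L v ≤ k → L (nbr v p) < L v → lab (nbr v p) ≢ D →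
                    rounds v ≤ suc (rounds (nbr v p))
    rounds-exempt {v} {p} Lv≤k lower ≢D with L-suc v
    ... | j , eq = rounds≤ (exempt⇒E Lv≤k
      (≤-trans (s≤s (≤-trans (rounds≤ (label-lab {v = nbr v p} ≤-refl))
                 (T-mono (≤-pred (subst (L (nbr v p) <_) eq lower)))))
               (subst (T j <_) (sym (T-pred eq)) (s≤s (m≤m+n _ _))))
      (p , lower , _ , label-rounds (nbr v p) , ≢D))

    upTo-level : ℕ → Fin n → ℕ
    upTo-level i v = when (L v ≤? i) (rounds v)

    down? : ∀ i → Decidable (λ d → L (tail d) ≤ i × L (head d) ≡ suc i)
    down? i d = (L (tail d) ≤? i) ×-dec (L (head d) ≟ suc i)

    below : ℕ → Dart → ℕ
    below i d = when (down? i d) (rounds (tail d))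

    -- At level i + 1 a non-exempt node pays its deadline, an exempt one a single round on top of
    -- those of some lower neighbour. Summing over all lower neighbours avoids having to select that
    -- one.
    upTo-level-suc : ∀ {i} → suc i ≤ k → ∀ v →
      upTo-level (suc i) v ≤ upTo-level i v + (when (on-level? i v) (T (suc i))
                             + (1 + sum (map (λ p → below i (v , p)) (allFin (deg v)))))
    upTo-level-suc {i} i<k v = when-≤ (L v ≤? suc i) λ le → case m≤n⇒m<n∨m≡n le of λ
      { (inj₁ (s≤s le′)) → ≤-trans (≤-when (L v ≤? i) le′) (m≤m+n _ _)
      ; (inj₂ eq)        → ≤-trans (at eq (E? (lab v))) (m≤n+m _ (upTo-level i v))
      }
      where
      at : L v ≡ suc i → Dec (lab v ≡ E) → rounds v ≤ when (on-level? i v) (T (suc i))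
                             + (1 + sum (map (λ p → below i (v , p)) (allFin (deg v))))
      at eq (no on) = ≤-trans (rounds≤ (label-lab (≤-reflexive (cong T eq))))
                        (≤-trans (≤-when (on-level? i v) (eq , on)) (m≤m+n _ _))
      at eq (yes ≡E) with E⇒lower (subst (_≤ k) (sym eq) i<k) ≡E
      ... | p , lower , ≢D = ≤-trans (rounds-exempt (subst (_≤ k) (sym eq) i<k) lower ≢D) (≤-trans
              (s≤s (≤-trans (≤-when (down? i (v , p)) (≤-pred (subst (L (nbr v p) <_) eq lower) , eq))
                            (∈⇒≤sum (λ p → below i (v , p)) (∈-allFin p))))
              (m≤n+m _ _))

    -- Reversed, these darts have their lower node as head and a higher one as tail. So they are
    -- good, and `charge` bills every lower node at most twice.
    sum-below : ∀ {i} → i ≤ k →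
      sum (map (λ v → sum (map (λ p → below i (v , p)) (allFin (deg v)))) (allFin n))
        ≤ 2 * sum (map (upTo-level i) (allFin n))
    sum-below {i} i≤k = begin
      sum (map (λ v → sum (map (λ p → below i (v , p)) (allFin (deg v)))) (allFin n))
        ≡⟨ cong sum (map-cong (λ v → cong sum (map-∘ (allFin (deg v)))) (allFin n)) ⟩
      sum (map (λ v → sum (map (below i) (map (v ,_) (allFin (deg v))))) (allFin n))
        ≡⟨ sum-concatMap (below i) (λ v → map (v ,_) (allFin (deg v))) (allFin n) ⟨
      sum (map (below i) allDarts)
        ≡⟨ sum-when (down? i) (rounds ∘ tail) allDarts ⟩
      sum (map (rounds ∘ tail) downs)
        ≤⟨ sum-map-mono (rounds ∘ tail) downs (λ {d} d∈ → ≤-when (L (tail d) ≤? i) (proj₁ (down d∈))) ⟩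
      sum (map (upTo-level i ∘ head ∘ flip) downs)
        ≤⟨ charge (upTo-level i) flip downs
             (Unique.map⁺ (λ {d} {d′} eq → trans (sym (flip-flip d)) (trans (cong flip eq) (flip-flip d′)))
               (Unique.filter⁺ (down? i) unique-allDarts))
             good ⟩
      2 * sum (map (upTo-level i) (allFin n)) ∎
      where
      open ≤-Reasoning
      downs : List Dart
      downs = filter (down? i) allDarts
      down : ∀ {d} → d ∈ˡ downs → L (tail d) ≤ i × L (head d) ≡ suc i
      down d∈ = proj₂ (∈-filter⁻ (down? i) {xs = allDarts} d∈)
      good : ∀ {d} → d ∈ˡ downs → Good (flip d)
      good {d} d∈ with down d∈
      ... | le , eq = ≤-trans le i≤k ,
        ≤-trans le (≤-trans (n≤1+n i) (≤-reflexive (trans (sym eq) (cong L (sym (tail-flip d))))))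

    sum-upTo-level-suc : ∀ {i} → suc i ≤ k →
      sum (map (upTo-level (suc i)) (allFin n)) ≤
        sum (map (upTo-level i) (allFin n))
          + (length (active i) * T (suc i) + (n + 2 * sum (map (upTo-level i) (allFin n))))
    sum-upTo-level-suc {i} i<k = begin
      sum (map (upTo-level (suc i)) (allFin n))
        ≤⟨ sum-map-mono _ (allFin n) (λ {v} _ → upTo-level-suc i<k v) ⟩
      sum (map (λ v → a v + (b v + (1 + c′ v))) (allFin n))
        ≡⟨ sum-map-+ a _ (allFin n) ⟩
      sum (map a (allFin n)) + sum (map (λ v → b v + (1 + c′ v)) (allFin n))
        ≡⟨ cong (sum (map a (allFin n)) +_) (sum-map-+ b _ (allFin n)) ⟩
      sum (map a (allFin n)) + (sum (map b (allFin n)) + sum (map (λ v → 1 + c′ v) (allFin n)))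
        ≡⟨ cong (λ s → sum (map a (allFin n)) + (sum (map b (allFin n)) + s)) (sum-map-+ (λ _ → 1) c′ (allFin n)) ⟩
      sum (map a (allFin n)) + (sum (map b (allFin n)) + (sum (map (λ _ → 1) (allFin n)) + sum (map c′ (allFin n))))
        ≡⟨ cong₂ (λ x y → sum (map a (allFin n)) + (x + (y + sum (map c′ (allFin n)))))
             (trans (sum-when (on-level? i) (λ _ → T (suc i)) (allFin n)) (sum-map-const (T (suc i)) (active i)))
             (trans (sum-map-const 1 (allFin n)) (trans (*-identityʳ _) (length-tabulate id))) ⟩
      sum (map a (allFin n)) + (length (active i) * T (suc i) + (n + sum (map c′ (allFin n))))
        ≤⟨ +-monoʳ-≤ (sum (map a (allFin n))) (+-monoʳ-≤ (length (active i) * T (suc i)) (+-monoʳ-≤ n (sum-below (<⇒≤ i<k)))) ⟩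
      sum (map a (allFin n)) + (length (active i) * T (suc i) + (n + 2 * sum (map a (allFin n)))) ∎
      where
      open ≤-Reasoning
      a b c′ : Fin n → ℕ
      a  = upTo-level i
      b v = when (on-level? i v) (T (suc i))
      c′ v = sum (map (λ p → below i (v , p)) (allFin (deg v)))

    sum-upTo-level-0 : sum (map (upTo-level 0) (allFin n)) ≡ 0
    sum-upTo-level-0 = n≤0⇒n≡0 (≤-trans
      (sum-map-mono (upTo-level 0) (allFin n) (λ {v} _ → when-≤ (L v ≤? 0) λ le → contradiction le (<⇒≱ (Levels.level≥1 graph k v))))
      (≤-reflexive (trans (sum-map-const 0 (allFin n)) (*-zeroʳ (length (allFin n))))))

    -- The summand `n * suc k` covers the nodes of level k + 1, which all end by round k + 1.
    sum-rounds : foldr _+_ 0 rounds ≤ sum (map (upTo-level k) (allFin n)) + n * suc k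
    sum-rounds = begin
      foldr _+_ 0 rounds                                        ≡⟨ sum-allFin rounds ⟩
      sum (map rounds (allFin n))                               ≤⟨ sum-map-mono rounds (allFin n) (λ {v} _ → node v (m≤n⇒m<n∨m≡n (level≤ k v))) ⟩
      sum (map (λ v → upTo-level k v + suc k) (allFin n))       ≡⟨ sum-map-+ (upTo-level k) (λ _ → suc k) (allFin n) ⟩
      sum (map (upTo-level k) (allFin n)) + sum (map (λ _ → suc k) (allFin n))
        ≡⟨ cong (sum (map (upTo-level k) (allFin n)) +_) (trans (sum-map-const (suc k) (allFin n)) (cong (_* suc k) {length (allFin n)} {n} (length-tabulate id))) ⟩
      sum (map (upTo-level k) (allFin n)) + n * suc k           ∎
      where
      open ≤-Reasoning
      node : ∀ v → L v < suc k ⊎ L v ≡ suc k → rounds v ≤ upTo-level k v + suc k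
      node v (inj₁ (s≤s le)) = ≤-trans (≤-when (L v ≤? k) le) (m≤m+n _ _)
      node v (inj₂ top)      = ≤-trans (rounds≤ (label-top top)) (m≤n+m _ _)

-- Rational averages and integer roots

/-mono-≤ : ∀ {a b n} .{{_ : NonZero n}} → a ≤ b * n → pos a ℚ./ n ℚ.≤ pos b ℚ./ 1
/-mono-≤ {a} {b} {suc d} le = ℚ.toℚᵘ-cancel-≤ (begin
  toℚᵘ (pos a ℚ./ suc d)   ≃⟨ ℚ.toℚᵘ-fromℚᵘ (mkℚᵘ (pos a) d) ⟩
  mkℚᵘ (pos a) d           ≤⟨ *≤* (subst₂ ℤ._≤_ (sym (ℤ.*-identityʳ (pos a))) (ℤ.pos-* b (suc d)) (ℤ.+≤+ le)) ⟩
  mkℚᵘ (pos b) 0           ≃⟨ ℚ.toℚᵘ-fromℚᵘ (mkℚᵘ (pos b) 0) ⟨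
  toℚᵘ (pos b ℚ./ 1)       ∎)
  where open ℚᵘ.≤-Reasoning

/1-* : ∀ a b → (pos a ℚ./ 1) ℚ.* (pos b ℚ./ 1) ≡ pos (a * b) ℚ./ 1
/1-* a b = ℚ.toℚᵘ-injective (begin
  toℚᵘ ((pos a ℚ./ 1) ℚ.* (pos b ℚ./ 1))           ≈⟨ ℚ.toℚᵘ-homo-* (pos a ℚ./ 1) (pos b ℚ./ 1) ⟩
  toℚᵘ (pos a ℚ./ 1) ℚᵘ.* toℚᵘ (pos b ℚ./ 1)       ≈⟨ ℚᵘ.*-cong (ℚ.toℚᵘ-fromℚᵘ (mkℚᵘ (pos a) 0)) (ℚ.toℚᵘ-fromℚᵘ (mkℚᵘ (pos b) 0)) ⟩
  mkℚᵘ (pos a) 0 ℚᵘ.* mkℚᵘ (pos b) 0               ≈⟨ *≡* (cong (ℤ._* pos 1) (sym (ℤ.pos-* a b))) ⟩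
  mkℚᵘ (pos (a * b)) 0                           ≈⟨ ℚ.toℚᵘ-fromℚᵘ (mkℚᵘ (pos (a * b)) 0) ⟨
  toℚᵘ (pos (a * b) ℚ./ 1)                       ∎)
  where open import Relation.Binary.Reasoning.Setoid ℚᵘ.≃-setoid

nonNegative-/ : ∀ a n .{{_ : NonZero n}} → NonNegative (pos a ℚ./ n)
nonNegative-/ a n = ℚ.normalize-nonNeg a n

^-/1-≤ : ∀ {p : ℚ} {b} .{{_ : NonNegative p}} → p ℚ.≤ pos b ℚ./ 1 → ∀ m → p ^ℚ m ℚ.≤ pos (b ^ m) ℚ./ 1
^-/1-≤ le zero = ℚ.≤-refl
^-/1-≤ {p} {b} le (suc m) = begin
  p ℚ.* (p ^ℚ m)                         ≤⟨ ℚ.*-monoˡ-≤-nonNeg p (^-/1-≤ le m) ⟩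
  p ℚ.* (pos (b ^ m) ℚ./ 1)                ≤⟨ ℚ.*-monoʳ-≤-nonNeg (pos (b ^ m) ℚ./ 1) {{nonNegative-/ (b ^ m) 1}} le ⟩
  (pos b ℚ./ 1) ℚ.* (pos (b ^ m) ℚ./ 1)      ≡⟨ /1-* b (b ^ m) ⟩
  pos (b * b ^ m) ℚ./ 1                    ∎
  where open ℚ.≤-Reasoning

^-distribʳ-* : ∀ m a b → (a * b) ^ m ≡ a ^ m * b ^ m
^-distribʳ-* zero    a b = refl
^-distribʳ-* (suc m) a b = trans (cong (a * b *_) (^-distribʳ-* m a b))
  ([m*n]*[o*p]≡[m*o]*[n*p] a b (a ^ m) (b ^ m))

-- A natural number `b` above the average moves the comparison of powers from ℚ to ℕ.
/-^-≤ : ∀ {a b c x n} m .{{_ : NonZero n}} → a ≤ b * n → b ^ m ≤ c ^ m * x →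
        (pos a ℚ./ n) ≤ c · x ^1/ m
/-^-≤ {a} {b} {c} {x} {n} m le pow = ℚ.≤-trans
  (^-/1-≤ {{nonNegative-/ a n}} (/-mono-≤ {a} {b} le) m)
  (/-mono-≤ {b ^ m} {c ^ m * x} {1} (≤-trans pow (≤-reflexive (sym (*-identityʳ _)))))

-- Passing from x to suc x at most doubles the root.
root : ∀ m → 1 ≤ m → ∀ x → ∃[ M ] 1 ≤ M × x < M ^ m × M ^ m ≤ 2 ^ m * suc x
root m 1≤m zero = 1 , ≤-refl , ≤-reflexive (sym (^-zeroˡ m)) ,
  ≤-trans (^-monoˡ-≤ m {1} {2} (s≤s z≤n)) (≤-reflexive (sym (*-identityʳ _)))
root m 1≤m (suc x) with root m 1≤m x
... | M , 1≤M , lt , le with suc x <? M ^ m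
...   | yes lt′ = M , 1≤M , lt′ , ≤-trans le (*-monoʳ-≤ (2 ^ m) (n≤1+n _))
...   | no ≮    = suc M , s≤s z≤n , ≤-trans (s≤s lt) (^-monoˡ-< m {{>-nonZero 1≤m}} (n<1+n M)) ,
        (begin
          suc M ^ m            ≤⟨ ^-monoˡ-≤ m (≤-trans (+-monoˡ-≤ M 1≤M) (≤-reflexive (cong (λ x → M + x) (sym (+-identityʳ M))))) ⟩
          (2 * M) ^ m          ≡⟨ ^-distribʳ-* m 2 M ⟩
          2 ^ m * M ^ m        ≤⟨ *-monoʳ-≤ (2 ^ m) (≤-trans (≮⇒≥ ≮) (n≤1+n _)) ⟩
          2 ^ m * suc (suc x)  ∎)
  where open ≤-Reasoning

-- Choice of the parameters and the final estimate

-- This is 2^j - 1, written as the sum of the exponents of the first j thresholds, so that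
-- `M ^ mersenne j` is their product.
mersenne : ℕ → ℕ
mersenne zero    = 0
mersenne (suc j) = 2 ^ j + mersenne j

suc-mersenne : ∀ j → suc (mersenne j) ≡ 2 ^ j
suc-mersenne zero    = refl
suc-mersenne (suc j) = trans (sym (+-suc (2 ^ j) (mersenne j)))
  (cong (2 ^ j +_) (trans (suc-mersenne j) (sym (+-identityʳ (2 ^ j)))))

module Parameters (k : ℕ) (1≤k : 1 ≤ k) where

  m : ℕ
  m = 2 ^ k ∸ 1

  m≡ : m ≡ mersenne k
  m≡ = cong (_∸ 1) (sym (suc-mersenne k))

  1≤m : 1 ≤ m
  1≤m = m<n⇒0<n∸m (^-monoʳ-< 2 (s≤s (s≤s z≤n)) 1≤k)

  base : ℕ → ℕ
  base n = proj₁ (root m 1≤m (2 ^ k * n))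

  1≤base : ∀ n → 1 ≤ base n
  1≤base n = proj₁ (proj₂ (root m 1≤m (2 ^ k * n)))

  <base^m : ∀ n → 2 ^ k * n < base n ^ m
  <base^m n = proj₁ (proj₂ (proj₂ (root m 1≤m (2 ^ k * n))))

  base^m≤ : ∀ n → base n ^ m ≤ 2 ^ m * suc (2 ^ k * n)
  base^m≤ n = proj₂ (proj₂ (proj₂ (root m 1≤m (2 ^ k * n))))

  threshold : ℕ → ℕ → ℕ
  threshold n j = base n ^ (2 ^ j)

  1≤threshold : ∀ n j → 1 ≤ threshold n j
  1≤threshold n j = m^n>0 (base n) {{>-nonZero (1≤base n)}} (2 ^ j)

  open Protocol k threshold using (deadline; algorithm)

  deadline≤     : ∀ n j → deadline n j ≤ (suc k + 4 * j) * threshold n j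
  -- The thresholds increase, so a deadline is proportional to its last summand. The cost estimate
  -- needs this sharp index; `deadline≤` gives up one index to carry the induction.
  deadline-suc≤ : ∀ n j → deadline n (suc j) ≤ (suc k + 4 * suc j) * threshold n j

  deadline≤ n zero = ≤-trans (m≤m*n (suc k) (threshold n 0) {{>-nonZero (1≤threshold n 0)}})
                             (*-monoˡ-≤ (threshold n 0) (m≤m+n (suc k) 0))
  deadline≤ n (suc j) = ≤-trans (deadline-suc≤ n j)
    (*-monoʳ-≤ (suc k + 4 * suc j)
      (^-monoʳ-≤ (base n) {{>-nonZero (1≤base n)}} (^-monoʳ-≤ 2 (n≤1+n j))))

  deadline-suc≤ n j = begin
    deadline n j + (3 + θ)                 ≤⟨ +-mono-≤ (deadline≤ n j) (+-monoˡ-≤ θ (*-monoʳ-≤ 3 (1≤threshold n j))) ⟩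
    (suc k + 4 * j) * θ + (3 * θ + θ)      ≡⟨ distribute k j θ ⟩
    (suc k + 4 * suc j) * θ                ∎
    where
    open ≤-Reasoning
    θ = threshold n j
    distribute : ∀ k j θ → (suc k + 4 * j) * θ + (3 * θ + θ) ≡ (suc k + 4 * suc j) * θ
    distribute = solve-∀

  -- The first factor bounds the one in `deadline-suc≤` for every level up to k; the power 2^k
  -- bounds the 2^j of `active-mersenne`.
  windowCost : ℕ
  windowCost = (suc k + 4 * k) * 2 ^ k

  -- This is the recursion of `sum-upTo-level-suc` in units of n · M: lower levels, deadlines of
  -- active nodes, one round per node, and twice the lower levels for exemptions.
  levelCost : ℕ → ℕ
  levelCost zero    = 0
  levelCost (suc i) = levelCost i + (windowCost + (1 + 2 * levelCost i))

  totalCost : ℕ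
  totalCost = levelCost k + suc k

  -- The factor 2 is the loss in `root`; `2 ^ suc k` absorbs `suc (2 ^ k * n)` into a multiple of n.
  constant : ℕ
  constant = totalCost * (2 * 2 ^ suc k)

  module _ {Δ c n : ℕ} (I : Instance Δ c n) where
    open Counting k threshold I
    open Rounds k threshold I

    private
      M = base n
      θ = threshold n

    active-mersenne : ∀ j → suc j ≤ k → length (active j) * M ^ mersenne j ≤ 2 ^ j * n
    active-mersenne zero _ = begin
      length (active 0) * 1       ≡⟨ *-identityʳ _ ⟩
      length (active 0)           ≤⟨ length-filter (on-level? 0) (allFin n) ⟩
      length (allFin n)           ≡⟨ length-tabulate id ⟩
      n                           ≡⟨ +-identityʳ n ⟨
      2 ^ 0 * n                   ∎
      where open ≤-Reasoning
    active-mersenne (suc j) ssj≤k = begin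
      a′ * M ^ (2 ^ j + mersenne j)        ≡⟨ cong (a′ *_) (^-distribˡ-+-* M (2 ^ j) (mersenne j)) ⟩
      a′ * (θ j * M ^ mersenne j)          ≡⟨ sym (*-assoc a′ (θ j) _) ⟩
      a′ * θ j * M ^ mersenne j            ≤⟨ *-monoˡ-≤ (M ^ mersenne j) (active-suc ssj≤k (1≤threshold n j)) ⟩
      2 * a * M ^ mersenne j               ≡⟨ *-assoc 2 a _ ⟩
      2 * (a * M ^ mersenne j)             ≤⟨ *-monoʳ-≤ 2 (active-mersenne j (<⇒≤ ssj≤k)) ⟩
      2 * (2 ^ j * n)                      ≡⟨ sym (*-assoc 2 (2 ^ j) n) ⟩
      2 ^ suc j * n                        ∎
      where
      open ≤-Reasoning
      a  = length (active j)
      a′ = length (active (suc j))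

    -- The exponent m is 2^j + mersenne j, so `M ^ m` is θ j times the factor that already
    -- accompanies the active nodes in `active-mersenne`, and this factor cancels.
    active-last : ∀ {j} → suc j ≡ k → length (active j) ≤ θ j
    active-last {j} refl = <⇒≤ (*-cancelʳ-< (M ^ mersenne j) (length (active j)) (θ j) (begin-strict
      length (active j) * M ^ mersenne j   ≤⟨ active-mersenne j ≤-refl ⟩
      2 ^ j * n                            ≤⟨ *-monoˡ-≤ n (^-monoʳ-≤ 2 (n≤1+n j)) ⟩
      2 ^ k * n                            <⟨ <base^m n ⟩
      M ^ m                                ≡⟨ cong (M ^_) m≡ ⟩
      M ^ (2 ^ j + mersenne j)             ≡⟨ ^-distribˡ-+-* M (2 ^ j) (mersenne j) ⟩
      θ j * M ^ mersenne j                 ∎))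
      where open ≤-Reasoning

    -- The threshold is `M * M ^ mersenne j`; the decay of the active nodes pays for all of it
    -- except one factor M.
    window-cost : ∀ {j} → suc j ≤ k → length (active j) * deadline n (suc j) ≤ windowCost * (n * M)
    window-cost {j} sj≤k = begin
      a * deadline n (suc j)                       ≤⟨ *-monoʳ-≤ a (≤-trans (deadline-suc≤ n j) (*-monoˡ-≤ (θ j) (+-monoʳ-≤ (suc k) (*-monoʳ-≤ 4 sj≤k)))) ⟩
      a * (q * θ j)                                ≡⟨ cong (λ x → a * (q * M ^ x)) (sym (suc-mersenne j)) ⟩
      a * (q * (M * M ^ mersenne j))               ≡⟨ rearrange a q M (M ^ mersenne j) ⟩
      q * (a * M ^ mersenne j * M)                 ≤⟨ *-monoʳ-≤ q (*-monoˡ-≤ M (≤-trans (active-mersenne j sj≤k) (*-monoˡ-≤ n (^-monoʳ-≤ 2 (<⇒≤ sj≤k))))) ⟩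
      q * (2 ^ k * n * M)                          ≡⟨ regroup q (2 ^ k) n M ⟩
      windowCost * (n * M)                         ∎
      where
      open ≤-Reasoning
      a = length (active j)
      q = suc k + 4 * k
      rearrange : ∀ a q M x → a * (q * (M * x)) ≡ q * (a * x * M)
      rearrange = solve-∀
      regroup : ∀ q p n M → q * (p * n * M) ≡ q * p * (n * M)
      regroup = solve-∀

    n≤n*M : n ≤ n * M
    n≤n*M = m≤m*n n M {{>-nonZero (1≤base n)}}

    module _ (e : Execution algorithm I) where
      open Execution e

      level-cost : ∀ i → i ≤ k → sum (map (upTo-level e i) (allFin n)) ≤ levelCost i * (n * M)
      level-cost zero    _   = ≤-reflexive (sum-upTo-level-0 e)
      level-cost (suc i) i<k = begin
        sum (map (upTo-level e (suc i)) (allFin n))                ≤⟨ sum-upTo-level-suc e i<k ⟩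
        s + (length (active i) * deadline n (suc i) + (n + 2 * s)) ≤⟨ +-mono-≤ ih (+-mono-≤ (window-cost i<k) (+-mono-≤ n≤n*M (*-monoʳ-≤ 2 ih))) ⟩
        levelCost i * (n * M) + (windowCost * (n * M) + (n * M + 2 * (levelCost i * (n * M))))
                                                                   ≡⟨ collect (levelCost i) windowCost (n * M) ⟩
        levelCost (suc i) * (n * M)                                ∎
        where
        open ≤-Reasoning
        s = sum (map (upTo-level e i) (allFin n))
        ih : s ≤ levelCost i * (n * M)
        ih = level-cost i (<⇒≤ i<k)
        collect : ∀ l w x → l * x + (w * x + (x + 2 * (l * x))) ≡ (l + (w + (1 + 2 * l))) * x
        collect = solve-∀

      total-rounds : foldr _+_ 0 rounds ≤ (totalCost * M) * n
      total-rounds = begin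
        foldr _+_ 0 rounds                                         ≤⟨ sum-rounds e ⟩
        sum (map (upTo-level e k) (allFin n)) + n * suc k          ≤⟨ +-mono-≤ (level-cost k ≤-refl) (*-monoˡ-≤ (suc k) n≤n*M) ⟩
        levelCost k * (n * M) + n * M * suc k                      ≡⟨ collect (levelCost k) (suc k) n M ⟩
        totalCost * M * n                                          ∎
        where
        open ≤-Reasoning
        collect : ∀ l x n M → l * (n * M) + n * M * x ≡ (l + x) * M * n
        collect = solve-∀

      average-rounds : nodeAverage e ≤ constant · n ^1/ m
      average-rounds = /-^-≤ {b = totalCost * M} {constant} m {{Instance.nonEmpty I}} total-rounds (begin
        (totalCost * M) ^ m                                  ≡⟨ ^-distribʳ-* m totalCost M ⟩
        totalCost ^ m * M ^ m                                ≤⟨ *-monoʳ-≤ (totalCost ^ m) (≤-trans (base^m≤ n) (*-monoʳ-≤ (2 ^ m) 1+2^k*n≤)) ⟩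
        totalCost ^ m * (2 ^ m * (2 ^ suc k * n))            ≤⟨ *-monoʳ-≤ (totalCost ^ m) (*-monoʳ-≤ (2 ^ m) (*-monoˡ-≤ n x≤x^m)) ⟩
        totalCost ^ m * (2 ^ m * ((2 ^ suc k) ^ m * n))      ≡⟨ regroup (totalCost ^ m) (2 ^ m) ((2 ^ suc k) ^ m) n ⟩
        totalCost ^ m * (2 ^ m * (2 ^ suc k) ^ m) * n        ≡⟨ cong (λ x → totalCost ^ m * x * n) (sym (^-distribʳ-* m 2 (2 ^ suc k))) ⟩
        totalCost ^ m * (2 * 2 ^ suc k) ^ m * n              ≡⟨ cong (_* n) (sym (^-distribʳ-* m totalCost (2 * 2 ^ suc k))) ⟩
        constant ^ m * n                                     ∎)
        where
        open ≤-Reasoning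
        1≤n : 1 ≤ n
        1≤n = >-nonZero⁻¹ n {{Instance.nonEmpty I}}
        1+2^k*n≤ : suc (2 ^ k * n) ≤ 2 ^ suc k * n
        1+2^k*n≤ = begin
          1 + 2 ^ k * n             ≤⟨ +-monoˡ-≤ (2 ^ k * n) (*-mono-≤ (m^n>0 2 k) 1≤n) ⟩
          2 ^ k * n + 2 ^ k * n     ≡⟨ double (2 ^ k) n ⟩
          2 ^ suc k * n             ∎
          where
          double : ∀ p n → p * n + p * n ≡ 2 * p * n
          double = solve-∀
        -- The constant enters the bound as an m-th power, so this factor must be raised to it too.
        x≤x^m : 2 ^ suc k ≤ (2 ^ suc k) ^ m
        x≤x^m = ≤-trans (≤-reflexive (sym (^-identityʳ _))) (^-monoʳ-≤ (2 ^ suc k) {{>-nonZero (m^n>0 2 (suc k))}} 1≤m)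
        regroup : ∀ t a b n → t * (a * (b * n)) ≡ t * (a * b) * n
        regroup = solve-∀

theorem3 : (k : ℕ) → 1 ≤ k → (Δ c : ℕ) →
    ProblemNodeAveragedO-root Δ c (Hierarchical2½Coloring k) (2 ^ k ∸ 1)
theorem3 k 1≤k Δ c =
    Protocol.algorithm k threshold
  , (λ I → Rounds.execution k threshold I , Counting.colouring k threshold I 1≤k (active-last I))
  , constant , 0 , λ _ I e → average-rounds I e
  where open Parameters k 1≤k
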